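{- Let $\mathbb F$ be a field and let $\preceq$ be any one of the four reductions $\leq_{\mathsf p}$, $\leq_{\mathsf c}$, $\trianglelefteq_{\mathsf p}$, $\trianglelefteq_{\mathsf c}$. For each $\mathcal C\in\{\mathrm{VNP},\mathrm{VP},\mathrm{VBP},\mathrm{VF}\}$ (over $\mathbb F$), fix a family $(K)$ that is $\mathcal C$-complete under $\leq_{\mathsf p}$; for instance $(K)=(\mathrm{HC})$ when $\mathcal C=\mathrm{VNP}$. Then the following two statements hold for every $(f)\in\mathcal C$. (1) (The complete families are dense in $\mathcal C$.) There is a $\mathsf p$-family $(g)$ over $\mathbb F[\varepsilon]$ such that $(K)\preceq (f)+\varepsilon\cdot(g)$. (2) (The non-complete families are dense in $\mathcal C$.) There is a $\mathsf p$-family $(g)$ over $\mathbb F[\varepsilon]$ such that $(f)+\varepsilon\cdot(g)\in\mathcal C(\mathbb F(\varepsilon))$ and $(K)\not\leq_{\mathsf p}(f)+\varepsilon\cdot(g)$.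
   Context: Let $\varepsilon$ be an indeterminate. $\mathsf p$-families. A $\mathsf p$-family $(f)=(f_n)_{n\in\mathbb N}$ is a sequence of multivariate polynomials in which both the number of variables of $f_n$ and the degree of $f_n$ are polynomially bounded in $n$. Circuits and classes. An algebraic circuit is a rooted directed acyclic graph whose leaves are labelled by variables or field constants and whose internal nodes are $+$ or $\times$ gates. Its size is its number of nodes. - VP is the set of $\mathsf p$-families computable by circuits of polynomially bounded size. - VBP is the same with skew circuits, in which every multiplication gate has a leaf as one of its inputs. - VF is the same with formulas, i.e. circuits that are trees. - The Hamiltonian cycle polynomial is $\mathrm{HC}_n=\sum_{\pi}\prod_{i=1}^n x_{i,\pi(i)}$, where $\pi$ ranges over the $n$-cycles in the symmetric group $\mathfrak S_n$. - VNP is the set of $\mathsf p$-families $(f)$ with $(f)\leq_{\mathsf p}(\mathrm{HC})$. - $\mathcal C(\mathbb F(\varepsilon))$ denotes the class defined in the same way over the field $\mathbb F(\varepsilon)$. Projections. A polynomial $f$ is a projection of $g$, written $f\le g$, if $f$ is obtained from $g$ by substituting each variable of $g$ by a variable or a field constant. We write $(f)\leq_{\mathsf p}(g)$ if there is a polynomially bounded $t:\mathbb N\to\mathbb N$ with $f_n\le g_{t(n)}$ for all $n$. Oracle reductions. The oracle complexity $L^g(f)$ is the minimum size of a circuit with $+$, $\times$ and $g$-oracle gates that computes $f$; a $g$-oracle gate outputs $g$ evaluated at its inputs. We write $(f)\leq_{\mathsf c}(g)$ if there is a polynomially bounded $t$ such that $L^{g_{t(n)}}(f_n)$ is polynomially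 bounded in $n$. Border reductions. All reductions are also interpreted over the field $\mathbb F(\varepsilon)$. - A polynomial $f$ is a border projection of $g$, written $f\trianglelefteq g$, if $f+\varepsilon h\le g$ for some polynomial $h$ over $\mathbb F[\varepsilon]$. - $(f)\trianglelefteq_{\mathsf p}(g)$ if $f_n\trianglelefteq g_{t(n)}$ for some polynomially bounded $t$. - The border oracle complexity $\overline{L^g}(f)$ is the least $c$ such that $L^g_{\mathbb F(\varepsilon)}(f+\varepsilon h)\le c$ for some polynomial $h$ over $\mathbb F[\varepsilon]$. - $(f)\trianglelefteq_{\mathsf c}(g)$ if $\overline{L^{g_{t(n)}}}(f_n)$ is polynomially bounded for some polynomially bounded $t$. Completeness. A family $(K)\in\mathcal C$ is $\mathcal C$-complete under $\leq_{\mathsf p}$ if $(h)\leq_{\mathsf p}(K)$ for every $(h)\in\mathcal C$. Examples: the determinant for VBP, iterated $3\times3$ matrix multiplication for VF, and certain graph homomorphism polynomials for VP. - $\mathrm{VNPC}(\preceq)=\{(f)\in\mathrm{VNP}:(\mathrm{HC})\preceq(f)\}$. - $\mathrm{VFC}(\preceq)$, $\mathrm{VBPC}(\preceq)$ and $\mathrm{VPC}(\preceq)$ are defined analogously, requiring $(h)\preceq(f)$ for all $(h)$ in the class. Closures and density. A family $(f)$ lies in the closure $\overline{\mathrm{VNPC}(\preceq)}$ if $(\mathrm{HC})\preceq(f)+\varepsilon(g)$ for some $\mathsf p$-family $(g)$ over $\mathbb F[\varepsilon]$. A family $(f)$ lies in $\overline{\mathrm{VNP}\setminus\mathrm{VNPC}(\leq_{\mathsf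 p})}$ if $(f)+\varepsilon(g)\in\mathrm{VNP}(\mathbb F(\varepsilon))$ and $(\mathrm{HC})\not\leq_{\mathsf p}(f)+\varepsilon(g)$ for some such $(g)$. The paper defines the closures for VF, VBP and VP analogously, using their complete families. A subset $S\subseteq\mathcal C$ is called dense in $\mathcal C$ if $\overline S=\mathcal C$. -}

module Defs where

open import Level using (0ℓ)
open import Algebra.Bundles using (CommutativeRing)
open import Algebra.Bundles.Raw using (RawRing)
open import Data.Nat using (ℕ; zero; suc; _≤_)
open import Data.Nat.Properties using (m≤m⊔n; m≤n⊔m)
import Data.Nat as N
open import Data.Fin using (Fin; zero; suc; inject≤; combine) renaming (_≟_ to _≟F_)
open import Data.Fin.Base using () renaming (inject₁ to inj1)
open import Data.List using (List; []; _∷_; _++_; foldr; map; filter; allFin)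
open import Data.List.Relation.Unary.Unique.Propositional using (Unique)
open import Data.Vec using (Vec; []; _∷_; lookup; head)
open import Data.Product using (Σ; _×_; _,_; proj₁; proj₂)
open import Relation.Nullary.Decidable using () renaming (_×-dec_ to _×?_)
open import Data.Sum using (_⊎_; inj₁; inj₂)
open import Data.Empty using (⊥)
open import Data.Unit using (⊤; tt)
open import Data.Bool using (Bool; true; false)
open import Relation.Nullary using (¬_; Dec)
open import Relation.Binary.PropositionalEquality using (_≡_)
import Data.List.Relation.Unary.Unique.DecPropositional as UDec

record Field : Set₁ where
  field
    commRing : CommutativeRing 0ℓ 0ℓ
  open CommutativeRing commRing public
  field
    0≉1 : ¬ (0# ≈ 1#)
    inverse : ∀ x → ¬ (x ≈ 0#) → Σ Carrier λ y → (x * y) ≈ 1#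

-- Polynomials with coefficients in a (raw) commutative ring C and
-- variables in V: formal terms modulo the congruence generated by the
-- commutative-ring axioms and the ring structure of the constants.
-- The quotient is the polynomial ring C[V] (free commutative C-algebra).

module _ (C : RawRing 0ℓ 0ℓ) where
  open RawRing C

  infixl 6 _⊕_
  infixl 7 _⊗_

  data Term (V : Set) : Set where
    var : V → Term V
    con : Carrier → Term V
    _⊕_ : Term V → Term V → Term V
    _⊗_ : Term V → Term V → Term V

  infix 4 _~_
  data _~_ {V : Set} : Term V → Term V → Set where
    ~refl  : ∀ {a} → a ~ a
    ~sym   : ∀ {a b} → a ~ b → b ~ a
    ~trans : ∀ {a b c} → a ~ b → b ~ c → a ~ c
    ⊕-cong : ∀ {a b c d} → a ~ b → c ~ d → a ⊕ c ~ b ⊕ d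
    ⊗-cong : ∀ {a b c d} → a ~ b → c ~ d → a ⊗ c ~ b ⊗ d
    ⊕-assoc : ∀ a b c → (a ⊕ b) ⊕ c ~ a ⊕ (b ⊕ c)
    ⊕-comm  : ∀ a b → a ⊕ b ~ b ⊕ a
    ⊕-zero  : ∀ a → a ⊕ con 0# ~ a
    ⊕-inv   : ∀ a → a ⊕ (con (- 1#) ⊗ a) ~ con 0#
    ⊗-assoc : ∀ a b c → (a ⊗ b) ⊗ c ~ a ⊗ (b ⊗ c)
    ⊗-comm  : ∀ a b → a ⊗ b ~ b ⊗ a
    ⊗-one   : ∀ a → a ⊗ con 1# ~ a
    distrib : ∀ a b c → a ⊗ (b ⊕ c) ~ (a ⊗ b) ⊕ (a ⊗ c)
    con-≈   : ∀ {x y} → x ≈ y → con x ~ con y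
    con-+   : ∀ x y → con (x + y) ~ con x ⊕ con y
    con-*   : ∀ x y → con (x * y) ~ con x ⊗ con y

  deg : ∀ {V : Set} → Term V → ℕ
  deg (var _) = 1
  deg (con _) = 0
  deg (a ⊕ b) = deg a N.⊔ deg b
  deg (a ⊗ b) = deg a N.+ deg b

  fsize : ∀ {V : Set} → Term V → ℕ
  fsize (var _) = 1
  fsize (con _) = 1
  fsize (a ⊕ b) = suc (fsize a N.+ fsize b)
  fsize (a ⊗ b) = suc (fsize a N.+ fsize b)

  subst : ∀ {V W : Set} → (V → Term W) → Term V → Term W
  subst σ (var v) = σ v
  subst σ (con c) = con c
  subst σ (a ⊕ b) = subst σ a ⊕ subst σ b
  subst σ (a ⊗ b) = subst σ a ⊗ subst σ b

  rename : ∀ {V W : Set} → (V → W) → Term V → Term W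
  rename ρ = subst (λ v → var (ρ v))

  projSubst : ∀ {V W : Set} → (V → W ⊎ Carrier) → V → Term W
  projSubst σ v with σ v
  ... | inj₁ w = var w
  ... | inj₂ c = con c

  sumT : ∀ {V : Set} → List (Term V) → Term V
  sumT = foldr _⊕_ (con 0#)

  prodT : ∀ {V : Set} → List (Term V) → Term V
  prodT = foldr _⊗_ (con 1#)

  record Fam : Set where
    field
      nv  : ℕ → ℕ
      pol : (n : ℕ) → Term (Fin (nv n))
  open Fam public

  PB : (ℕ → ℕ) → Set
  PB t = Σ ℕ λ c → ∀ n → t n ≤ c N.* (n N.^ c) N.+ c

  PFam : Fam → Set
  PFam f = PB (nv f) × Σ (ℕ → ℕ) λ d → PB d ×
           (∀ n → Σ (Term (Fin (nv f n))) λ t → (t ~ pol f n) × (deg t ≤ d n))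

  _≤proj_ : ∀ {a b} → Term (Fin a) → Term (Fin b) → Set
  _≤proj_ {a} {b} f g =
    Σ (Fin b → Fin a ⊎ Carrier) λ σ → f ~ subst (projSubst σ) g

  _≤p_ : Fam → Fam → Set
  f ≤p g = Σ (ℕ → ℕ) λ t → PB t × (∀ n → pol f n ≤proj pol g (t n))

  -- Circuits (straight-line programs), possibly with oracle gates.
  -- Each gate refers to previously computed gates (index 0 = most recent).
  -- Oracle gates: an oracle o of arity ar o computing op o; it is applied
  -- to ar o previously computed values.

  module Circuits (N : ℕ) (O : Set) (ar : O → ℕ) (op : (o : O) → Term (Fin (ar o))) where

    data Gate (k : ℕ) : Set where
      inp : Fin N → Gate k
      cst : Carrier → Gate k
      add : Fin k → Fin k → Gate k
      mul : Fin k → Fin k → Gate k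
      orc : (o : O) → (Fin (ar o) → Fin k) → Gate k

    data SLP : ℕ → Set where
      []  : SLP 0
      _▷_ : ∀ {k} → SLP k → Gate k → SLP (suc k)

    gateVal : ∀ {k} → Vec (Term (Fin N)) k → Gate k → Term (Fin N)
    gateVal vs (inp i) = var i
    gateVal vs (cst c) = con c
    gateVal vs (add i j) = lookup vs i ⊕ lookup vs j
    gateVal vs (mul i j) = lookup vs i ⊗ lookup vs j
    gateVal vs (orc o ι) = subst (λ x → lookup vs (ι x)) (op o)

    values : ∀ {k} → SLP k → Vec (Term (Fin N)) k
    values [] = []
    values (c ▷ g) = gateVal (values c) g ∷ values c

    output : ∀ {k} → SLP (suc k) → Term (Fin N)
    output c = head (values c)

    isLeaf : ∀ {k} → Gate k → Bool
    isLeaf (inp _) = true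
    isLeaf (cst _) = true
    isLeaf _ = false

    leaves : ∀ {k} → SLP k → Vec Bool k
    leaves [] = []
    leaves (c ▷ g) = isLeaf g ∷ leaves c

    Skew : ∀ {k} → SLP k → Set
    Skew [] = ⊤
    Skew (c ▷ mul i j) = Skew c × ((lookup (leaves c) i ≡ true) ⊎ (lookup (leaves c) j ≡ true))
    Skew (c ▷ _) = Skew c

  module Plain (N : ℕ) = Circuits N ⊥ (λ ()) (λ ())

  module WithOracle (N : ℕ) {b : ℕ} (g : Term (Fin b)) = Circuits N ⊤ (λ _ → b) (λ _ → g)

  CircSize≤ : ∀ {N} → Term (Fin N) → ℕ → Set
  CircSize≤ {N} f s = Σ ℕ λ k → Σ (Plain.SLP N (suc k)) λ c → (suc k ≤ s) × (Plain.output N c ~ f)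

  SkewSize≤ : ∀ {N} → Term (Fin N) → ℕ → Set
  SkewSize≤ {N} f s = Σ ℕ λ k → Σ (Plain.SLP N (suc k)) λ c →
    (suc k ≤ s) × Plain.Skew N c × (Plain.output N c ~ f)

  FormSize≤ : ∀ {N} → Term (Fin N) → ℕ → Set
  FormSize≤ {N} f s = Σ (Term (Fin N)) λ φ → (fsize φ ≤ s) × (φ ~ f)

  OracleSize≤ : ∀ {N b} → Term (Fin b) → Term (Fin N) → ℕ → Set
  OracleSize≤ {N} g f s = Σ ℕ λ k → Σ (WithOracle.SLP N g (suc k)) λ c →
    (suc k ≤ s) × (WithOracle.output N g c ~ f)

  _≤c_ : Fam → Fam → Set
  f ≤c g = Σ (ℕ → ℕ) λ t → PB t × Σ (ℕ → ℕ) λ s → PB s ×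
           (∀ n → OracleSize≤ (pol g (t n)) (pol f n) (s n))

  allFuns : (m n : ℕ) → List (Fin m → Fin n)
  allFuns zero n = (λ ()) ∷ []
  allFuns (suc m) n =
    foldr (λ j acc → map (λ h → λ { zero → j ; (suc i) → h i }) (allFuns m n) ++ acc)
          [] (allFin n)

  iter : ∀ {n} → (Fin n → Fin n) → ℕ → Fin n → Fin n
  iter π zero x = x
  iter π (suc m) x = π (iter π m x)

  orbit : ∀ {n} → (Fin n → Fin n) → ℕ → Fin n → List (Fin n)
  orbit π zero x = []
  orbit π (suc m) x = x ∷ orbit π m (π x)

  IsNCycle : ∀ {k} → (Fin (suc k) → Fin (suc k)) → Set
  IsNCycle {k} π = Unique (orbit π (suc k) zero) × (iter π (suc k) zero ≡ zero)

  isNCycle? : ∀ {k} → (π : Fin (suc k) → Fin (suc k)) → Dec (IsNCycle π)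
  isNCycle? {k} π = UDec.unique? _≟F_ (orbit π (suc k) zero) ×? (iter π (suc k) zero ≟F zero)

  nCycles : (n : ℕ) → List (Fin n → Fin n)
  nCycles zero = []
  nCycles (suc k) = filter isNCycle? (allFuns (suc k) (suc k))

  HCpoly : (n : ℕ) → Term (Fin (n N.* n))
  HCpoly n = sumT (map (λ π → prodT (map (λ i → var (combine i (π i))) (allFin n))) (nCycles n))

  HC : Fam
  HC = record { nv = λ n → n N.* n ; pol = HCpoly }

  InVP InVBP InVF InVNP : Fam → Set
  InVP f = PFam f × Σ (ℕ → ℕ) λ s → PB s × (∀ n → CircSize≤ (pol f n) (s n))
  InVBP f = PFam f × Σ (ℕ → ℕ) λ s → PB s × (∀ n → SkewSize≤ (pol f n) (s n))
  InVF f = PFam f × Σ (ℕ → ℕ) λ s → PB s × (∀ n → FormSize≤ (pol f n) (s n))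
  InVNP f = PFam f × (f ≤p HC)

data Class : Set where
  VNP VP VBP VF : Class

Member : (C : RawRing 0ℓ 0ℓ) → Class → Fam C → Set
Member C VNP f = InVNP C f
Member C VP  f = InVP C f
Member C VBP f = InVBP C f
Member C VF  f = InVF C f

IsComplete : (C : RawRing 0ℓ 0ℓ) → Class → Fam C → Set
IsComplete C 𝒞 K = Member C 𝒞 K × (∀ (h : Fam C) → Member C 𝒞 h → _≤p_ C h K)

mapCoef : {C D : RawRing 0ℓ 0ℓ} → (RawRing.Carrier C → RawRing.Carrier D) →
          ∀ {V : Set} → Term C V → Term D V
mapCoef h (var v) = var v
mapCoef h (con c) = con (h c)
mapCoef h (a ⊕ b) = mapCoef h a ⊕ mapCoef h b
mapCoef h (a ⊗ b) = mapCoef h a ⊗ mapCoef h b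

mapFam : {C D : RawRing 0ℓ 0ℓ} → (RawRing.Carrier C → RawRing.Carrier D) → Fam C → Fam D
mapFam h f = record { nv = nv f ; pol = λ n → mapCoef h (pol f n) }

module _ (F : Field) where
  open Field F

  Fraw : RawRing 0ℓ 0ℓ
  Fraw = rawRing

  Fε[ε] : Set
  Fε[ε] = Term Fraw ⊤

  PolyRaw : RawRing 0ℓ 0ℓ
  PolyRaw = record
    { Carrier = Fε[ε]
    ; _≈_ = _~_ Fraw
    ; _+_ = _⊕_
    ; _*_ = _⊗_
    ; -_ = λ p → con (- 1#) ⊗ p
    ; 0# = con 0#
    ; 1# = con 1#
    }

  NZ : Set
  NZ = Σ Fε[ε] λ q → ¬ (_~_ Fraw q (con 0#))

  prodD : List NZ → Fε[ε]
  prodD L = prodT Fraw (map proj₁ L)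

  -- F(ε): fractions p / (q₁ ⋯ q_r) with all q_i nonzero,
  -- equality by cross-multiplication
  record Frac : Set where
    constructor _//_
    field
      num : Fε[ε]
      den : List NZ
  open Frac

  RatRaw : RawRing 0ℓ 0ℓ
  RatRaw = record
    { Carrier = Frac
    ; _≈_ = λ x y → _~_ Fraw (num x ⊗ prodD (den y)) (num y ⊗ prodD (den x))
    ; _+_ = λ x y → ((num x ⊗ prodD (den y)) ⊕ (num y ⊗ prodD (den x))) // (den x ++ den y)
    ; _*_ = λ x y → (num x ⊗ num y) // (den x ++ den y)
    ; -_ = λ x → (con (- 1#) ⊗ num x) // den x
    ; 0# = con 0# // []
    ; 1# = con 1# // []
    }

  ιF : Carrier → Frac
  ιF c = con c // []

  ιP : Fε[ε] → Frac
  ιP p = p // []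

  εR : Frac
  εR = var tt // []

  embF : Fam Fraw → Fam RatRaw
  embF = mapFam ιF

  plusEps : Fam Fraw → Fam PolyRaw → Fam RatRaw
  plusEps f g = record
    { nv = λ n → nv f n N.⊔ nv g n
    ; pol = λ n →
        rename RatRaw (λ i → inject≤ i (m≤m⊔n (nv f n) (nv g n))) (mapCoef ιF (pol f n))
        ⊕ (con εR ⊗ rename RatRaw (λ i → inject≤ i (m≤n⊔m (nv f n) (nv g n))) (mapCoef ιP (pol g n)))
    }

  _⊴p_ : Fam RatRaw → Fam RatRaw → Set
  f ⊴p h = Σ (ℕ → ℕ) λ t → PB RatRaw t × (∀ n →
    Σ (Term PolyRaw (Fin (nv f n))) λ H →
      _≤proj_ RatRaw (pol f n ⊕ (con εR ⊗ mapCoef ιP H)) (pol h (t n)))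

  _⊴c_ : Fam RatRaw → Fam RatRaw → Set
  f ⊴c h = Σ (ℕ → ℕ) λ t → PB RatRaw t × Σ (ℕ → ℕ) λ s → PB RatRaw s × (∀ n →
    Σ (Term PolyRaw (Fin (nv f n))) λ H →
      OracleSize≤ RatRaw (pol h (t n)) (pol f n ⊕ (con εR ⊗ mapCoef ιP H)) (s n))

data Red : Set where
  ≤p-red ≤c-red ⊴p-red ⊴c-red : Red

Reduces : (F : Field) → Red → Fam (RatRaw F) → Fam (RatRaw F) → Set
Reduces F ≤p-red f h = _≤p_ (RatRaw F) f h
Reduces F ≤c-red f h = _≤c_ (RatRaw F) f h
Reduces F ⊴p-red f h = _⊴p_ F f h
Reduces F ⊴c-red f h = _⊴c_ F f h

{-# OPTIONS --safe #-}

-- Density of the complete families: the family f(x) + ε z (K(y) − f(x)) projects to K at z = 1/ε.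
--
-- Density of the incomplete families: perturb f to f · ∏ᵢ (1 + ε xᵢ).  A single variable w belongs to
-- every class, so it would be a projection of the perturbed family if that family were complete.  But
-- if some xᵢ is projected to a variable, evaluating all variables at −1/ε kills the projection and not
-- w, and if all xᵢ are projected to constants, then the projection is constant.  The factors 1 + ε xᵢ
-- cost constantly many skew gates or formula nodes each; for VNP, each is realised by a gadget that
-- replaces one vertex of the weighted digraph underlying HC by three.
module Submission where

open import Defs
open import Level using (0ℓ)
open import Algebra.Bundles using (CommutativeRing)
open import Algebra.Bundles.Raw using (RawRing)
open import Data.Bool.Base using (Bool; true; false)
open import Data.Nat.Base as ℕ using (ℕ; zero; suc; z≤n; s≤s)
import Data.Nat.Properties as ℕ
open import Data.Fin.Base using (Fin; zero; suc; toℕ; fromℕ<; punchOut; inject≤; _↑ˡ_; _↑ʳ_; cast; splitAt; combine; remQuot)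
open import Data.Fin.Properties as Fin using (toℕ-injective; toℕ<n; toℕ-fromℕ<; pigeonhole; injective⇒≤; any?; all?; punchOut-injective)
open import Data.List.Base using (List; []; _∷_; _++_; foldr; map; filter; tabulate; allFin; length)
open import Data.List.Properties using (length-map; length-tabulate)
open import Data.List.Membership.Propositional using (_∈_)
open import Data.List.Membership.Propositional.Properties using (∈-allFin)
open import Data.List.Relation.Unary.All using (All; []; _∷_)
open import Data.List.Relation.Unary.AllPairs using ([]; _∷_)
open import Data.List.Relation.Unary.Any using (here; there)
open import Data.List.Relation.Unary.Unique.Propositional using (Unique)
open import Data.Vec.Base using ([]; _∷_; lookup)
open import Data.Vec.Functional using () renaming (_∷_ to _◂_)
open import Data.Product using (Σ; ∃; _×_; _,_; proj₁; proj₂; uncurry)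
open import Data.Sum.Base as Sum using (_⊎_; inj₁; inj₂)
open import Data.Unit.Base using (⊤; tt)
open import Function.Base using (_∘_; id)
open import Relation.Nullary using (¬_; Dec; yes; no; contradiction)
open import Relation.Nullary.Decidable using (map′; _×-dec_)
open import Relation.Unary using (Decidable)
open import Relation.Binary.Definitions using (tri<; tri≈; tri>)
open import Relation.Binary.PropositionalEquality as ≡ using (_≡_; _≢_; _≗_; cong; cong₂)

-- Equality of polynomials is a congruence generated by axioms, so an inequality can only be proved
-- through an invariant of that congruence. The value -1/ε is the root of 1 + ε x, and the
-- non-projection argument always ends in 1 = 0 over F(ε). Refuting this means carrying fractions
-- through every rule, and transitivity then needs F[ε] to be an integral domain. As equality in F
-- is not assumed decidable, this is available only up to double negation, which suffices because
-- the goal is itself a negation.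
--
-- For VNP the gadget must be verified on sums over all n-cycles. `IsNCycle` follows the orbit of
-- vertex 0 and behaves badly when an edge is contracted and the vertices are renumbered. It is
-- therefore exchanged for a condition without base point: every vertex reaches every vertex. The
-- sum then expands along its first row, each first edge being contracted, and two such expansions
-- evaluate the gadget.

-- Polynomially bounded functions

-- `PB` carries a coefficient ring as module parameter. This copy unfolds to the same type for every
-- ring, so bounds pass freely between F, F[ε] and F(ε).
PolyBounded : (ℕ → ℕ) → Set
PolyBounded t = Σ ℕ λ c → ∀ n → t n ℕ.≤ c ℕ.* n ℕ.^ c ℕ.+ c

polyBounded-≤ : ∀ {s t} → (∀ n → s n ℕ.≤ t n) → PolyBounded t → PolyBounded s
polyBounded-≤ s≤t (c , b) = c , λ n → ℕ.≤-trans (s≤t n) (b n)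

polyBounded-const : ∀ c → PolyBounded (λ _ → c)
polyBounded-const c = c , λ n → ℕ.m≤n+m c _

polyBounded-id : PolyBounded (λ n → n)
polyBounded-id = 1 , λ n → ℕ.≤-trans
  (ℕ.≤-reflexive (≡.sym (≡.trans (ℕ.*-identityˡ _) (ℕ.*-identityʳ n)))) (ℕ.m≤m+n _ 1)

-- Raising the exponent could fail only at n = 0, where 0^0 = 1. The exponent 0 comes with the
-- coefficient 0, so that case is harmless.
c*n^-mono : ∀ c d n → c ℕ.≤ d → c ℕ.* n ℕ.^ c ℕ.≤ c ℕ.* n ℕ.^ d
c*n^-mono zero    d n       _   = z≤n
c*n^-mono (suc c) d zero    _   = ℕ.≤-trans (ℕ.≤-reflexive (ℕ.*-zeroʳ c)) z≤n
c*n^-mono (suc c) d (suc n) c≤d = ℕ.*-monoʳ-≤ (suc c) (ℕ.^-monoʳ-≤ (suc n) c≤d)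

polyBounded-+ : ∀ {s t} → PolyBounded s → PolyBounded t → PolyBounded (λ n → s n ℕ.+ t n)
polyBounded-+ {s} {t} (c , bs) (d , bt) = c ℕ.+ d , λ n → let e = c ℕ.+ d in begin
  s n ℕ.+ t n                                          ≤⟨ ℕ.+-mono-≤ (bs n) (bt n) ⟩
  (c ℕ.* n ℕ.^ c ℕ.+ c) ℕ.+ (d ℕ.* n ℕ.^ d ℕ.+ d)      ≡⟨ +-interchange (c ℕ.* n ℕ.^ c) c _ d ⟩
  (c ℕ.* n ℕ.^ c ℕ.+ d ℕ.* n ℕ.^ d) ℕ.+ e              ≤⟨ ℕ.+-monoˡ-≤ e (ℕ.+-mono-≤
                                                            (c*n^-mono c e n (ℕ.m≤m+n c d))
                                                            (c*n^-mono d e n (ℕ.m≤n+m d c))) ⟩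
  (c ℕ.* n ℕ.^ e ℕ.+ d ℕ.* n ℕ.^ e) ℕ.+ e              ≡⟨ cong (ℕ._+ e) (ℕ.*-distribʳ-+ (n ℕ.^ e) c d) ⟨
  e ℕ.* n ℕ.^ e ℕ.+ e                                  ∎
  where
  open ℕ.≤-Reasoning
  open import Algebra.Properties.CommutativeSemigroup ℕ.+-commutativeSemigroup
    using () renaming (interchange to +-interchange)

polyBounded-* : ∀ k {t} → PolyBounded t → PolyBounded (λ n → k ℕ.* t n)
polyBounded-* zero    b = polyBounded-const 0
polyBounded-* (suc k) b = polyBounded-+ b (polyBounded-* k b)

-- Polynomial rings as syntax modulo ring axioms

module _ (C : RawRing 0ℓ 0ℓ) (V : Set) where
  private
    module C = RawRing C
    _≈_ = _~_ C {V}

    ⊕-identityˡ : ∀ a → (con C.0# ⊕ a) ≈ a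
    ⊕-identityˡ a = ~trans (⊕-comm _ _) (⊕-zero a)

  -- The ring laws are constructors of `_~_`, so `C` may be any raw ring. This matters for `RatRaw`,
  -- whose cross-multiplied equality is not shown to be transitive.
  termRing : CommutativeRing 0ℓ 0ℓ
  termRing = record
    { Carrier = Term C V
    ; _≈_ = _≈_
    ; _+_ = _⊕_
    ; _*_ = _⊗_
    ; -_  = con (C.- C.1#) ⊗_
    ; 0#  = con C.0#
    ; 1#  = con C.1#
    ; isCommutativeRing = record
      { isRing = record
        { +-isAbelianGroup = record
          { isGroup = record
            { isMonoid = record
              { isSemigroup = record
                { isMagma = record
                  { isEquivalence = record { refl = ~refl ; sym = ~sym ; trans = ~trans }
                  ; ∙-cong = ⊕-cong }
                ; assoc = ⊕-assoc }
              ; identity = ⊕-identityˡ , ⊕-zero }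
            ; inverse = (λ a → ~trans (⊕-comm _ _) (⊕-inv a)) , ⊕-inv
            ; ⁻¹-cong = ⊗-cong ~refl }
          ; comm = ⊕-comm }
        ; *-cong = ⊗-cong
        ; *-assoc = ⊗-assoc
        ; *-identity = (λ a → ~trans (⊗-comm _ _) (⊗-one a)) , ⊗-one
        ; distrib = distrib , λ a b c → ~trans (⊗-comm _ _)
            (~trans (distrib _ _ _) (⊕-cong (⊗-comm _ _) (⊗-comm _ _)))
        }
      ; *-comm = ⊗-comm
      }
    }

-- Negation enters the congruence only through the constant -1, so preserving that one value is
-- enough.
record CoefHom (C D : RawRing 0ℓ 0ℓ) : Set where
  private
    module C = RawRing C
    module D = RawRing D
  field
    ⟦_⟧     : C.Carrier → D.Carrier
    ⟦⟧-cong : ∀ {x y} → x C.≈ y → ⟦ x ⟧ D.≈ ⟦ y ⟧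
    +-homo  : ∀ x y → ⟦ x C.+ y ⟧ D.≈ ⟦ x ⟧ D.+ ⟦ y ⟧
    *-homo  : ∀ x y → ⟦ x C.* y ⟧ D.≈ ⟦ x ⟧ D.* ⟦ y ⟧
    -1-homo : ⟦ C.- C.1# ⟧ D.≈ D.- D.1#
    0#-homo : ⟦ C.0# ⟧ D.≈ D.0#
    1#-homo : ⟦ C.1# ⟧ D.≈ D.1#

termRawRing : RawRing 0ℓ 0ℓ → Set → RawRing 0ℓ 0ℓ
termRawRing C V = CommutativeRing.rawRing (termRing C V)

con-hom : ∀ {C D} → CoefHom C D → ∀ V → CoefHom C (termRawRing D V)
con-hom h V = record
  { ⟦_⟧ = λ c → con ⟦ c ⟧
  ; ⟦⟧-cong = λ p → con-≈ (⟦⟧-cong p)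
  ; +-homo = λ x y → ~trans (con-≈ (+-homo x y)) (con-+ _ _)
  ; *-homo = λ x y → ~trans (con-≈ (*-homo x y)) (con-* _ _)
  ; -1-homo = ~trans (con-≈ -1-homo) (~sym (⊗-one _))
  ; 0#-homo = con-≈ 0#-homo
  ; 1#-homo = con-≈ 1#-homo }
  where open CoefHom h

module _ {C : RawRing 0ℓ 0ℓ} (R : CommutativeRing 0ℓ 0ℓ) where
  open CommutativeRing R
  open import Algebra.Properties.Ring ring using (-1*x≈-x)

  eval : (RawRing.Carrier C → Carrier) → ∀ {V : Set} → (V → Carrier) → Term C V → Carrier
  eval i τ (var v) = τ v
  eval i τ (con c) = i c
  eval i τ (a ⊕ b) = eval i τ a + eval i τ b
  eval i τ (a ⊗ b) = eval i τ a * eval i τ b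

  eval-cong : (h : CoefHom C rawRing) → ∀ {V : Set} (τ : V → Carrier) {a b} → _~_ C a b →
              eval (CoefHom.⟦_⟧ h) τ a ≈ eval (CoefHom.⟦_⟧ h) τ b
  eval-cong h τ = go
    where
    open CoefHom h
    e = eval ⟦_⟧ τ
    go : ∀ {a b} → _~_ C a b → e a ≈ e b
    go ~refl            = refl
    go (~sym p)         = sym (go p)
    go (~trans p q)     = trans (go p) (go q)
    go (⊕-cong p q)     = +-cong (go p) (go q)
    go (⊗-cong p q)     = *-cong (go p) (go q)
    go (⊕-assoc a b c)  = +-assoc _ _ _
    go (⊕-comm a b)     = +-comm _ _
    go (⊕-zero a)       = trans (+-congˡ 0#-homo) (+-identityʳ _)
    go (⊕-inv a)        = trans (+-congˡ (trans (*-congʳ -1-homo) (-1*x≈-x _)))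
                            (trans (-‿inverseʳ _) (sym 0#-homo))
    go (⊗-assoc a b c)  = *-assoc _ _ _
    go (⊗-comm a b)     = *-comm _ _
    go (⊗-one a)        = trans (*-congˡ 1#-homo) (*-identityʳ _)
    go (distrib a b c)  = distribˡ _ _ _
    go (con-≈ p)        = ⟦⟧-cong p
    go (con-+ x y)      = +-homo x y
    go (con-* x y)      = *-homo x y

module _ {C D : RawRing 0ℓ 0ℓ} (R : CommutativeRing 0ℓ 0ℓ) where
  open CommutativeRing R

  eval-mapCoef : ∀ (h : RawRing.Carrier C → RawRing.Carrier D) i {V : Set} (τ : V → Carrier) a →
                 eval R i τ (mapCoef {C} {D} h a) ≡ eval {C} R (i ∘ h) τ a
  eval-mapCoef h i τ (var v) = ≡.refl
  eval-mapCoef h i τ (con c) = ≡.refl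
  eval-mapCoef h i τ (a ⊕ b) = cong₂ _+_ (eval-mapCoef h i τ a) (eval-mapCoef h i τ b)
  eval-mapCoef h i τ (a ⊗ b) = cong₂ _*_ (eval-mapCoef h i τ a) (eval-mapCoef h i τ b)

module _ {C : RawRing 0ℓ 0ℓ} where

  subst≡eval : ∀ {V W : Set} (σ : V → Term C W) a → subst C σ a ≡ eval (termRing C W) con σ a
  subst≡eval σ (var v) = ≡.refl
  subst≡eval σ (con c) = ≡.refl
  subst≡eval σ (a ⊕ b) = cong₂ _⊕_ (subst≡eval σ a) (subst≡eval σ b)
  subst≡eval σ (a ⊗ b) = cong₂ _⊗_ (subst≡eval σ a) (subst≡eval σ b)

  subst-cong : ∀ {V W : Set} (σ : V → Term C W) {a b} → _~_ C a b → _~_ C (subst C σ a) (subst C σ b)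
  subst-cong σ = go
    where
    go : ∀ {a b} → _~_ C a b → _~_ C (subst C σ a) (subst C σ b)
    go ~refl            = ~refl
    go (~sym p)         = ~sym (go p)
    go (~trans p q)     = ~trans (go p) (go q)
    go (⊕-cong p q)     = ⊕-cong (go p) (go q)
    go (⊗-cong p q)     = ⊗-cong (go p) (go q)
    go (⊕-assoc a b c)  = ⊕-assoc _ _ _
    go (⊕-comm a b)     = ⊕-comm _ _
    go (⊕-zero a)       = ⊕-zero _
    go (⊕-inv a)        = ⊕-inv _
    go (⊗-assoc a b c)  = ⊗-assoc _ _ _
    go (⊗-comm a b)     = ⊗-comm _ _
    go (⊗-one a)        = ⊗-one _
    go (distrib a b c)  = distrib _ _ _
    go (con-≈ p)        = con-≈ p
    go (con-+ x y)      = con-+ x y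
    go (con-* x y)      = con-* x y

  subst-ext : ∀ {V W : Set} {σ τ : V → Term C W} → (∀ v → σ v ≡ τ v) → ∀ a → subst C σ a ≡ subst C τ a
  subst-ext eq (var v) = eq v
  subst-ext eq (con c) = ≡.refl
  subst-ext eq (a ⊕ b) = cong₂ _⊕_ (subst-ext eq a) (subst-ext eq b)
  subst-ext eq (a ⊗ b) = cong₂ _⊗_ (subst-ext eq a) (subst-ext eq b)

  subst-subst : ∀ {U V W : Set} (τ : V → Term C W) (σ : U → Term C V) a →
                subst C τ (subst C σ a) ≡ subst C (subst C τ ∘ σ) a
  subst-subst τ σ (var v) = ≡.refl
  subst-subst τ σ (con c) = ≡.refl
  subst-subst τ σ (a ⊕ b) = cong₂ _⊕_ (subst-subst τ σ a) (subst-subst τ σ b)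
  subst-subst τ σ (a ⊗ b) = cong₂ _⊗_ (subst-subst τ σ a) (subst-subst τ σ b)

  deg-rename : ∀ {V W : Set} (ρ : V → W) a → deg C (rename C ρ a) ≡ deg C a
  deg-rename ρ (var v) = ≡.refl
  deg-rename ρ (con c) = ≡.refl
  deg-rename ρ (a ⊕ b) = cong₂ ℕ._⊔_ (deg-rename ρ a) (deg-rename ρ b)
  deg-rename ρ (a ⊗ b) = cong₂ ℕ._+_ (deg-rename ρ a) (deg-rename ρ b)

  fsize-rename : ∀ {V W : Set} (ρ : V → W) a → fsize C (rename C ρ a) ≡ fsize C a
  fsize-rename ρ (var v) = ≡.refl
  fsize-rename ρ (con c) = ≡.refl
  fsize-rename ρ (a ⊕ b) = cong₂ (λ m n → suc (m ℕ.+ n)) (fsize-rename ρ a) (fsize-rename ρ b)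
  fsize-rename ρ (a ⊗ b) = cong₂ (λ m n → suc (m ℕ.+ n)) (fsize-rename ρ a) (fsize-rename ρ b)

  toTerm : ∀ {W : Set} → W ⊎ RawRing.Carrier C → Term C W
  toTerm (inj₁ w) = var w
  toTerm (inj₂ c) = con c

  projSubst≡toTerm : ∀ {V W : Set} (σ : V → W ⊎ RawRing.Carrier C) v → projSubst C σ v ≡ toTerm (σ v)
  projSubst≡toTerm σ v with σ v
  ... | inj₁ w = ≡.refl
  ... | inj₂ c = ≡.refl

module _ {C D : RawRing 0ℓ 0ℓ} (h : RawRing.Carrier C → RawRing.Carrier D) where
  private
    mapCD = λ {V : Set} → mapCoef {C} {D} h {V}

  mapCoef≡eval : ∀ {V : Set} (a : Term C V) → mapCD a ≡ eval (termRing D V) (con ∘ h) var a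
  mapCoef≡eval (var v) = ≡.refl
  mapCoef≡eval (con c) = ≡.refl
  mapCoef≡eval (a ⊕ b) = cong₂ _⊕_ (mapCoef≡eval a) (mapCoef≡eval b)
  mapCoef≡eval (a ⊗ b) = cong₂ _⊗_ (mapCoef≡eval a) (mapCoef≡eval b)

  mapCoef-subst : ∀ {V W : Set} (σ : V → Term C W) a →
                  mapCD (subst C σ a) ≡ subst D (mapCD ∘ σ) (mapCD a)
  mapCoef-subst σ (var v) = ≡.refl
  mapCoef-subst σ (con c) = ≡.refl
  mapCoef-subst σ (a ⊕ b) = cong₂ _⊕_ (mapCoef-subst σ a) (mapCoef-subst σ b)
  mapCoef-subst σ (a ⊗ b) = cong₂ _⊗_ (mapCoef-subst σ a) (mapCoef-subst σ b)

  deg-mapCoef : ∀ {V : Set} (a : Term C V) → deg D (mapCD a) ≡ deg C a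
  deg-mapCoef (var v) = ≡.refl
  deg-mapCoef (con c) = ≡.refl
  deg-mapCoef (a ⊕ b) = cong₂ ℕ._⊔_ (deg-mapCoef a) (deg-mapCoef b)
  deg-mapCoef (a ⊗ b) = cong₂ ℕ._+_ (deg-mapCoef a) (deg-mapCoef b)

  fsize-mapCoef : ∀ {V : Set} (a : Term C V) → fsize D (mapCD a) ≡ fsize C a
  fsize-mapCoef (var v) = ≡.refl
  fsize-mapCoef (con c) = ≡.refl
  fsize-mapCoef (a ⊕ b) = cong₂ (λ m n → suc (m ℕ.+ n)) (fsize-mapCoef a) (fsize-mapCoef b)
  fsize-mapCoef (a ⊗ b) = cong₂ (λ m n → suc (m ℕ.+ n)) (fsize-mapCoef a) (fsize-mapCoef b)

mapCoef-∘ : ∀ {C D E : RawRing 0ℓ 0ℓ} (h′ : RawRing.Carrier D → RawRing.Carrier E)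
            (h : RawRing.Carrier C → RawRing.Carrier D) {V : Set} (a : Term C V) →
            mapCoef {D} {E} h′ (mapCoef {C} {D} h a) ≡ mapCoef {C} {E} (h′ ∘ h) a
mapCoef-∘ h′ h (var v) = ≡.refl
mapCoef-∘ h′ h (con c) = ≡.refl
mapCoef-∘ h′ h (a ⊕ b) = cong₂ _⊕_ (mapCoef-∘ h′ h a) (mapCoef-∘ h′ h b)
mapCoef-∘ h′ h (a ⊗ b) = cong₂ _⊗_ (mapCoef-∘ h′ h a) (mapCoef-∘ h′ h b)

mapCoef-cong : ∀ {C D} (h : CoefHom C D) {V : Set} {a b : Term C V} → _~_ C a b →
               _~_ D (mapCoef {C} {D} (CoefHom.⟦_⟧ h) a) (mapCoef {C} {D} (CoefHom.⟦_⟧ h) b)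
mapCoef-cong {C} {D} h {V} {a} {b} p
  rewrite mapCoef≡eval {C} {D} (CoefHom.⟦_⟧ h) a | mapCoef≡eval {C} {D} (CoefHom.⟦_⟧ h) b =
  eval-cong (termRing D V) (con-hom h V) var p

-- Cyclic permutations as transitive maps

data Reaches {n} (π : Fin n → Fin n) (x : Fin n) : Fin n → Set where
  here : Reaches π x x
  step : ∀ {y} → Reaches π x y → Reaches π x (π y)

reaches-trans : ∀ {n} {π : Fin n → Fin n} {x y z} → Reaches π x y → Reaches π y z → Reaches π x z
reaches-trans p here     = p
reaches-trans p (step q) = step (reaches-trans p q)

reaches-≗ : ∀ {n} {π π′ : Fin n → Fin n} → π ≗ π′ → ∀ {x y} → Reaches π x y → Reaches π′ x y
reaches-≗ eq here = here
reaches-≗ eq {x} (step {y} p) = ≡.subst (Reaches _ x) (≡.sym (eq y)) (step (reaches-≗ eq p))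

-- For a self-map of a nonempty finite set this says that it is a single cycle through all points.
-- Unlike `IsNCycle` it singles out no vertex and no length, so it transports along contractions.
Connected : ∀ {n} → (Fin n → Fin n) → Set
Connected π = ∀ x y → Reaches π x y

connected-≗ : ∀ {n} {π π′ : Fin n → Fin n} → π ≗ π′ → Connected π → Connected π′
connected-≗ eq c x y = reaches-≗ eq (c x y)

connected⇒surjective : ∀ {n} {π : Fin n → Fin n} → Connected π → ∀ y → ∃ λ x → π x ≡ y
connected⇒surjective {π = π} c y = last (c (π y) y)
  where
  last : ∀ {z} → Reaches π (π y) z → ∃ λ x → π x ≡ z
  last here         = y , ≡.refl
  last (step {x} p) = x , ≡.refl

module _ (C : RawRing 0ℓ 0ℓ) where

  iter-comm : ∀ {n} (π : Fin n → Fin n) a x → iter C π a (π x) ≡ π (iter C π a x)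
  iter-comm π zero    x = ≡.refl
  iter-comm π (suc a) x = cong π (iter-comm π a x)

  iter-+ : ∀ {n} (π : Fin n → Fin n) a b x → iter C π (a ℕ.+ b) x ≡ iter C π a (iter C π b x)
  iter-+ π zero    b x = ≡.refl
  iter-+ π (suc a) b x = cong π (iter-+ π a b x)

  iter⇒reaches : ∀ {n} (π : Fin n → Fin n) a x → Reaches π x (iter C π a x)
  iter⇒reaches π zero    x = here
  iter⇒reaches π (suc a) x = step (iter⇒reaches π a x)

  reaches⇒iter : ∀ {n} {π : Fin n → Fin n} {x y} → Reaches π x y → ∃ λ a → iter C π a x ≡ y
  reaches⇒iter here     = 0 , ≡.refl
  reaches⇒iter {π = π} (step p) with reaches⇒iter p
  ... | a , eq = suc a , cong π eq

  all-orbit⁺ : ∀ {n} {P : Fin n → Set} (π : Fin n → Fin n) m x →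
               (∀ a → a ℕ.< m → P (iter C π a x)) → All P (orbit C π m x)
  all-orbit⁺ π zero    x p = []
  all-orbit⁺ {P = P} π (suc m) x p = p 0 (s≤s z≤n) ∷
    all-orbit⁺ π m (π x) λ a a<m → ≡.subst P (≡.sym (iter-comm π a x)) (p (suc a) (s≤s a<m))

  all-orbit⁻ : ∀ {n} {P : Fin n → Set} (π : Fin n → Fin n) m x →
               All P (orbit C π m x) → ∀ a → a ℕ.< m → P (iter C π a x)
  all-orbit⁻ π (suc m) x (p ∷ ps) zero    _         = p
  all-orbit⁻ {P = P} π (suc m) x (p ∷ ps) (suc a) (s≤s a<m) =
    ≡.subst P (iter-comm π a x) (all-orbit⁻ π m (π x) ps a a<m)

  unique-orbit⁺ : ∀ {n} (π : Fin n → Fin n) m x →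
                  (∀ a b → a ℕ.< b → b ℕ.< m → iter C π a x ≢ iter C π b x) → Unique (orbit C π m x)
  unique-orbit⁺ π zero    x p = []
  unique-orbit⁺ π (suc m) x p =
    all-orbit⁺ π m (π x) (λ a a<m eq →
      p 0 (suc a) (s≤s z≤n) (s≤s a<m) (≡.trans eq (iter-comm π a x))) ∷
    unique-orbit⁺ π m (π x) λ a b a<b b<m eq → p (suc a) (suc b) (s≤s a<b) (s≤s b<m)
      (≡.trans (≡.sym (iter-comm π a x)) (≡.trans eq (iter-comm π b x)))

  unique-orbit⁻ : ∀ {n} (π : Fin n → Fin n) m x → Unique (orbit C π m x) →
                  ∀ a b → a ℕ.< b → b ℕ.< m → iter C π a x ≢ iter C π b x
  unique-orbit⁻ π (suc m) x (p ∷ ps) zero (suc b) _ (s≤s b<m) eq =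
    all-orbit⁻ π m (π x) p b b<m (≡.trans eq (≡.sym (iter-comm π b x)))
  unique-orbit⁻ π (suc m) x (p ∷ ps) (suc a) (suc b) (s≤s a<b) (s≤s b<m) eq =
    unique-orbit⁻ π m (π x) ps a b a<b b<m
      (≡.trans (iter-comm π a x) (≡.trans eq (≡.sym (iter-comm π b x))))

  module _ {k} {π : Fin (suc k) → Fin (suc k)} where
    private
      it : ℕ → Fin (suc k)
      it a = iter C π a zero

    -- If y were missed, punching it out would inject the `suc k` distinct iterates into `Fin k`.
    isNCycle⇒iter-surjective : IsNCycle C π → ∀ y → ∃ λ a → a ℕ.< suc k × it a ≡ y
    isNCycle⇒iter-surjective (uniq , _) y with any? (λ a → it (toℕ a) Fin.≟ y)
    ... | yes (a , eq) = toℕ a , toℕ<n a , eq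
    ... | no ∄a = contradiction (injective⇒≤ inj) ℕ.1+n≰n
      where
      y≢ : ∀ a → y ≢ it (toℕ a)
      y≢ a eq = ∄a (a , ≡.sym eq)
      inj : ∀ {a b} → punchOut (y≢ a) ≡ punchOut (y≢ b) → a ≡ b
      inj {a} {b} eq with ℕ.<-cmp (toℕ a) (toℕ b)
      ... | tri< lt _ _ = contradiction (punchOut-injective (y≢ a) (y≢ b) eq)
                            (unique-orbit⁻ π (suc k) zero uniq _ _ lt (toℕ<n b))
      ... | tri≈ _ e _ = toℕ-injective e
      ... | tri> _ _ gt = contradiction (≡.sym (punchOut-injective (y≢ a) (y≢ b) eq))
                            (unique-orbit⁻ π (suc k) zero uniq _ _ gt (toℕ<n a))

    -- From x the orbit is followed until it closes at zero, and from there out to y.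
    isNCycle⇒connected : IsNCycle C π → Connected π
    isNCycle⇒connected c x y with isNCycle⇒iter-surjective c x | isNCycle⇒iter-surjective c y
    ... | a , a<n , ≡.refl | b , _ , ≡.refl =
      reaches-trans (≡.subst (Reaches π (it a)) back (iter⇒reaches π (suc k ℕ.∸ a) (it a)))
                    (iter⇒reaches π b zero)
      where
      back : iter C π (suc k ℕ.∸ a) (it a) ≡ zero
      back = ≡.trans (≡.sym (iter-+ π (suc k ℕ.∸ a) a zero))
               (≡.trans (cong it (ℕ.m∸n+n≡m (ℕ.<⇒≤ a<n))) (proj₂ c))

    -- The iterate of order `suc k` is the identity everywhere, so the iterate of order k is a left
    -- inverse of π.
    isNCycle⇒injective : IsNCycle C π → ∀ {x y} → π x ≡ π y → x ≡ y
    isNCycle⇒injective c {x} {y} eq = ≡.trans (≡.sym (period x)) (≡.trans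
      (≡.trans (≡.sym (iter-comm π k x)) (≡.trans (cong (iter C π k) eq) (iter-comm π k y))) (period y))
      where
      period : ∀ x → iter C π (suc k) x ≡ x
      period x with isNCycle⇒iter-surjective c x
      ... | a , _ , ≡.refl = ≡.trans (≡.sym (iter-+ π (suc k) a zero)) (≡.trans (cong it (ℕ.+-comm (suc k) a))
              (≡.trans (iter-+ π a (suc k) zero) (cong (iter C π a) (proj₂ c))))

    module _ (conn : Connected π) where

      -- A repetition it a ≡ it b confines the whole orbit to its first b entries.
      repetition⇒long : ∀ {a b} → a ℕ.< b → it a ≡ it b → suc k ℕ.≤ b
      repetition⇒long {a} {b} a<b eq = injective⇒≤ {f = index} index-injective
        where
        early : ∀ c → ∃ λ c′ → c′ ℕ.< b × it c′ ≡ it c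
        early zero = 0 , ℕ.≤-<-trans z≤n a<b , ≡.refl
        early (suc c) with early c
        ... | c′ , c′<b , e with ℕ.m≤n⇒m<n∨m≡n c′<b
        ... | inj₁ lt     = suc c′ , lt , cong π e
        ... | inj₂ ≡.refl = a , a<b , ≡.trans eq (cong π e)
        find : ∀ y → ∃ λ c → c ℕ.< b × it c ≡ y
        find y with reaches⇒iter (conn zero y)
        ... | c , ≡.refl = early c
        index : Fin (suc k) → Fin b
        index y = fromℕ< (proj₁ (proj₂ (find y)))
        index-injective : ∀ {x y} → index x ≡ index y → x ≡ y
        index-injective {x} {y} e with find x | find y
        ... | c , c<b , ex | d , d<b , ey = ≡.trans (≡.sym ex) (≡.trans (cong it
                (≡.trans (≡.sym (toℕ-fromℕ< c<b)) (≡.trans (cong toℕ e) (toℕ-fromℕ< d<b)))) ey)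

      -- Injectivity is not yet known, so the a common steps cannot be cancelled. Instead
      -- connectivity supplies r further steps that move `it a` on to zero, and the repetition moves
      -- along with it.
      repetition⇒period : ∀ {a b} → a ℕ.< b → it a ≡ it b → it (b ℕ.∸ a) ≡ zero
      repetition⇒period {a} {b} a<b eq with reaches⇒iter (conn (it a) zero)
      ... | r , back = begin
        it (b ℕ.∸ a)                     ≡⟨ cong (iter C π (b ℕ.∸ a)) back ⟨
        iter C π (b ℕ.∸ a) (iter C π r (it a)) ≡⟨ iter-+ π (b ℕ.∸ a) r (it a) ⟨
        iter C π (b ℕ.∸ a ℕ.+ r) (it a)  ≡⟨ iter-+ π (b ℕ.∸ a ℕ.+ r) a zero ⟨
        it (b ℕ.∸ a ℕ.+ r ℕ.+ a)         ≡⟨ cong it shuffle ⟩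
        it (r ℕ.+ b)                     ≡⟨ iter-+ π r b zero ⟩
        iter C π r (it b)                ≡⟨ cong (iter C π r) eq ⟨
        iter C π r (it a)                ≡⟨ back ⟩
        zero                             ∎
        where
        open ≡.≡-Reasoning
        shuffle : b ℕ.∸ a ℕ.+ r ℕ.+ a ≡ r ℕ.+ b
        shuffle = ≡.trans (cong (ℕ._+ a) (ℕ.+-comm (b ℕ.∸ a) r))
                    (≡.trans (ℕ.+-assoc r (b ℕ.∸ a) a) (cong (r ℕ.+_) (ℕ.m∸n+n≡m (ℕ.<⇒≤ a<b))))

      -- For the closing condition, the pigeonhole principle finds a repetition among the first
      -- `suc k` + 1 iterates. The difference of its indices is a period at zero and at most
      -- `suc k`, while `repetition⇒long`, applied to the repetition of zero itself, makes it at
      -- least `suc k`.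
      connected⇒isNCycle : IsNCycle C π
      connected⇒isNCycle =
        unique-orbit⁺ π (suc k) zero (λ a b a<b b<n eq → ℕ.<⇒≱ b<n (repetition⇒long a<b eq)) , closes
        where
        closes : it (suc k) ≡ zero
        closes with pigeonhole (ℕ.n<1+n (suc k)) (it ∘ toℕ)
        ... | i , j , i<j , eq = ≡.subst (λ b → it b ≡ zero) b≡n period
          where
          a = toℕ i
          period = repetition⇒period i<j eq
          b≡n : toℕ j ℕ.∸ a ≡ suc k
          b≡n = ℕ.≤-antisym (ℕ.≤-trans (ℕ.m∸n≤m (toℕ j) a) (ℕ.≤-pred (toℕ<n j)))
                  (repetition⇒long (ℕ.m<n⇒0<n∸m i<j) (≡.sym period))

connected⇒injective : ∀ {k} {π : Fin (suc k) → Fin (suc k)} → RawRing 0ℓ 0ℓ → Connected π →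
                      ∀ {x y} → π x ≡ π y → x ≡ y
connected⇒injective C c = isNCycle⇒injective C (connected⇒isNCycle C c)

-- contract v undoes a detour j → 0 → suc v, read as an edge j → v; expand v reinserts it.

contract : ∀ {n} → Fin n → Fin (suc n) → Fin n
contract v zero    = v
contract v (suc j) = j

expand : ∀ {n} → Fin n → Fin n → Fin (suc n)
expand v j with j Fin.≟ v
... | yes _ = zero
... | no  _ = suc j

contract-expand : ∀ {n} (v j : Fin n) → contract v (expand v j) ≡ j
contract-expand v j with j Fin.≟ v
... | yes e = ≡.sym e
... | no  _ = ≡.refl

expand-contract : ∀ {n} (v : Fin n) j → j ≢ suc v → expand v (contract v j) ≡ j
expand-contract v zero _ with v Fin.≟ v
... | yes _  = ≡.refl
... | no v≢v = contradiction ≡.refl v≢v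
expand-contract v (suc j) j≢ with j Fin.≟ v
... | yes e = contradiction (cong suc e) j≢
... | no _  = ≡.refl

module _ {n} (v : Fin n) where

  -- `contract v` sends both ends of the edge from `zero` to `suc v` to `v`, so this edge becomes an
  -- empty walk and every other edge a single step.
  connected-contract : ∀ {h : Fin n → Fin (suc n)} → Connected (suc v ◂ h) → Connected (contract v ∘ h)
  connected-contract {h} c x y = go (c (suc x) (suc y))
    where
    go : ∀ {z} → Reaches (suc v ◂ h) (suc x) z → Reaches (contract v ∘ h) x (contract v z)
    go here               = here
    go (step {zero} p)    = go p
    go (step {suc _} p)   = step (go p)

  -- An edge of π lifts to one step, or to two steps through zero if it ends in v. Zero itself is
  -- reached from a predecessor of v, which exists by surjectivity.
  connected-expand : ∀ {π : Fin n → Fin n} → Connected π → Connected (suc v ◂ (expand v ∘ π))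
  connected-expand {π} c = conn
    where
    π⁺ = suc v ◂ (expand v ∘ π)
    π⁺-step : ∀ j → Reaches π⁺ (suc j) (suc (π j))
    π⁺-step j with π j Fin.≟ v | step {π = π⁺} {x = suc j} {y = suc j} here
    ... | yes e | p = ≡.subst (λ z → Reaches π⁺ (suc j) (suc z)) (≡.sym e) (step p)
    ... | no _  | p = p
    lift : ∀ {x y} → Reaches π x y → Reaches π⁺ (suc x) (suc y)
    lift here         = here
    lift (step {y} p) = reaches-trans (lift p) (π⁺-step y)
    toZero : ∀ x → Reaches π⁺ (suc x) zero
    toZero x with connected⇒surjective c v
    ... | u , e = ≡.subst (Reaches π⁺ (suc x)) expanded (step (lift (c x u)))
      where
      expanded : expand v (π u) ≡ zero
      expanded with π u Fin.≟ v
      ... | yes _ = ≡.refl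
      ... | no ne = contradiction e ne
    conn : Connected π⁺
    conn zero    zero    = here
    conn zero    (suc y) = reaches-trans (step here) (lift (c v y))
    conn (suc x) zero    = toZero x
    conn (suc x) (suc y) = lift (c x y)

-- Hamiltonian cycle sums over a commutative ring

abstract
  -- Walks have unbounded length, so the decision goes through the finite test for `IsNCycle`. It
  -- can be abstract because the sums below depend only on which maps are connected, not on how this
  -- is decided.
  connected? : RawRing 0ℓ 0ℓ → ∀ {k} (π : Fin (suc k) → Fin (suc k)) → Dec (Connected π)
  connected? C π = map′ (isNCycle⇒connected C) (connected⇒isNCycle C) (isNCycle? C π)

noFin : ∀ {n} → Fin 0 → Fin n
noFin ()

_≗?_ : ∀ {m n} (f g : Fin m → Fin n) → Dec (f ≗ g)
f ≗? g = all? λ i → f i Fin.≟ g i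

◂-≗ : ∀ {n} {A : Set} {x y : A} {f g : Fin n → A} → x ≡ y → f ≗ g → (x ◂ f) ≗ (y ◂ g)
◂-≗ e eq zero    = e
◂-≗ e eq (suc i) = eq i

◂-η : ∀ {n} {A : Set} (f : Fin (suc n) → A) → (f zero ◂ (f ∘ suc)) ≗ f
◂-η f zero    = ≡.refl
◂-η f (suc i) = ≡.refl

module Hamiltonian (R : CommutativeRing 0ℓ 0ℓ) where
  open CommutativeRing R hiding (zero) renaming (Carrier to A)
  open import Algebra.Properties.Semiring.Sum semiring
  open import Relation.Binary.Reasoning.Setoid setoid

  ind : {P : Set} → Dec P → A → A
  ind (yes _) a = a
  ind (no  _) a = 0#

  ind-cong : ∀ {P Q : Set} (p : Dec P) (q : Dec Q) {a b} → (P → Q) → (Q → P) → (P → Q → a ≈ b) →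
             ind p a ≈ ind q b
  ind-cong (yes p) (yes q) to from eq = eq p q
  ind-cong (yes p) (no ¬q) to from eq = contradiction (to p) ¬q
  ind-cong (no ¬p) (yes q) to from eq = contradiction (from q) ¬p
  ind-cong (no ¬p) (no ¬q) to from eq = refl

  ind-congˡ : ∀ {P : Set} (p : Dec P) {a b} → a ≈ b → ind p a ≈ ind p b
  ind-congˡ p eq = ind-cong p p (λ x → x) (λ x → x) (λ _ _ → eq)

  ind-× : ∀ {P Q : Set} (p : Dec P) (q : Dec Q) {a} → ind p (ind q a) ≈ ind (p ×-dec q) a
  ind-× (yes _) (yes _) = refl
  ind-× (yes _) (no _)  = refl
  ind-× (no _)  q       = refl

  ind-* : ∀ {P : Set} (p : Dec P) a b → ind p (a * b) ≈ a * ind p b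
  ind-* (yes _) a b = refl
  ind-* (no _)  a b = sym (zeroʳ a)

  ind-no : ∀ {P : Set} (p : Dec P) a → ¬ P → ind p a ≈ 0#
  ind-no (yes p) a ¬p = contradiction p ¬p
  ind-no (no _)  a _  = refl

  sum-0 : ∀ {n} {t : Fin n → A} → (∀ i → t i ≈ 0#) → sum t ≈ 0#
  sum-0 {n} eq = trans (sum-cong-≋ eq) (sum-replicate-zero n)

  sum-δ : ∀ {n} (c : Fin n) (f : Fin n → A) → sum (λ j → ind (j Fin.≟ c) (f j)) ≈ f c
  sum-δ {suc n} zero f = trans (+-congˡ (sum-0 {n} λ j → ind-no (suc j Fin.≟ zero) (f (suc j)) λ ())) (+-identityʳ _)
  sum-δ {suc n} (suc c) f = trans (+-congˡ (trans
      (sum-cong-≋ {n} λ j → ind-cong (suc j Fin.≟ suc c) (j Fin.≟ c) Fin.suc-injective (cong suc) λ _ _ → refl)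
      (sum-δ c (f ∘ suc))))
    (+-identityˡ _)

  ∑→ : ∀ m n → ((Fin m → Fin n) → A) → A
  ∑→ zero    n F = F noFin
  ∑→ (suc m) n F = sum λ j → ∑→ m n λ h → F (j ◂ h)

  -- Without function extensionality an index function is determined only up to `≗`, so reindexing a
  -- sum requires summands that respect it.
  Extensional : ∀ {m n} → ((Fin m → Fin n) → A) → Set
  Extensional F = ∀ {f g} → f ≗ g → F f ≈ F g

  ∑→-cong : ∀ m {n} {F G : (Fin m → Fin n) → A} → (∀ h → F h ≈ G h) → ∑→ m n F ≈ ∑→ m n G
  ∑→-cong zero    eq = eq _
  ∑→-cong (suc m) {n} eq = sum-cong-≋ {n} λ j → ∑→-cong m λ h → eq (j ◂ h)

  ∑→-0 : ∀ m {n} {F : (Fin m → Fin n) → A} → (∀ h → F h ≈ 0#) → ∑→ m n F ≈ 0#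
  ∑→-0 zero    eq = eq _
  ∑→-0 (suc m) {n} eq = sum-0 {n} λ j → ∑→-0 m λ h → eq (j ◂ h)

  ∑→-* : ∀ m {n} x (F : (Fin m → Fin n) → A) → ∑→ m n (λ h → x * F h) ≈ x * ∑→ m n F
  ∑→-* zero    x F = refl
  ∑→-* (suc m) {n} x F = trans (sum-cong-≋ {n} λ j → ∑→-* m x λ h → F (j ◂ h))
    (sym (*-distribˡ-sum {n} x _))

  ∑→-ind-* : ∀ m {n} {P : (Fin m → Fin n) → Set} (P? : Decidable P) x (F : (Fin m → Fin n) → A) →
             ∑→ m n (λ h → ind (P? h) (x * F h)) ≈ x * ∑→ m n (λ h → ind (P? h) (F h))
  ∑→-ind-* m P? x F = trans (∑→-cong m λ h → ind-* (P? h) x (F h)) (∑→-* m x λ h → ind (P? h) (F h))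

  ∑→-sum-comm : ∀ m {n l} (F : (Fin m → Fin n) → Fin l → A) →
                ∑→ m n (λ h → sum (F h)) ≈ sum λ i → ∑→ m n λ h → F h i
  ∑→-sum-comm zero    F = refl
  ∑→-sum-comm (suc m) {n} {l} F = trans (sum-cong-≋ {n} λ j → ∑→-sum-comm m λ h → F (j ◂ h))
    (∑-comm {n} {l} _)

  ∑→-comm : ∀ m {n} m′ {n′} (F : (Fin m → Fin n) → (Fin m′ → Fin n′) → A) →
            ∑→ m n (λ h → ∑→ m′ n′ (F h)) ≈ ∑→ m′ n′ λ h′ → ∑→ m n λ h → F h h′
  ∑→-comm zero    m′ F = refl
  ∑→-comm (suc m) {n} m′ F = trans (sum-cong-≋ {n} λ j → ∑→-comm m m′ λ h → F (j ◂ h))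
    (sym (∑→-sum-comm m′ λ h′ (j : Fin n) → ∑→ m n λ h → F (j ◂ h) h′))

  ∑→-ind : ∀ {P : Set} (p : Dec P) m {n} (F : (Fin m → Fin n) → A) →
           ∑→ m n (λ h → ind p (F h)) ≈ ind p (∑→ m n F)
  ∑→-ind (yes _) m F = refl
  ∑→-ind (no _)  m F = ∑→-0 m λ _ → refl

  ∑→-δ : ∀ m {n} (c : Fin m → Fin n) {F} → Extensional F → ∑→ m n (λ h → ind (h ≗? c) (F h)) ≈ F c
  ∑→-δ zero    c {F} ext = trans
    (ind-cong (noFin ≗? c) (yes tt) {b = F noFin} (λ _ → tt) (λ _ ()) λ _ _ → refl) (ext λ ())
  ∑→-δ (suc m) {n} c {F} ext = begin
    sum (λ j → ∑→ m _ λ h → ind ((j ◂ h) ≗? c) (F (j ◂ h)))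
      ≈⟨ (sum-cong-≋ {n} λ j → ∑→-cong m λ h → trans
            (ind-cong ((j ◂ h) ≗? c) ((j Fin.≟ c zero) ×-dec (h ≗? (c ∘ suc)))
              (λ eq → eq zero , eq ∘ suc)
              (λ { (e , eq) zero → e ; (e , eq) (suc i) → eq i }) λ _ _ → refl)
            (sym (ind-× (j Fin.≟ c zero) (h ≗? (c ∘ suc))))) ⟩
    sum (λ j → ∑→ m _ λ h → ind (j Fin.≟ c zero) (ind (h ≗? (c ∘ suc)) (F (j ◂ h))))
      ≈⟨ (sum-cong-≋ {n} λ j → ∑→-ind (j Fin.≟ c zero) m _) ⟩
    sum (λ j → ind (j Fin.≟ c zero) (∑→ m _ λ h → ind (h ≗? (c ∘ suc)) (F (j ◂ h))))
      ≈⟨ (sum-cong-≋ {n} λ j → ind-congˡ (j Fin.≟ c zero) (∑→-δ m (c ∘ suc) (ext ∘ ◂-≗ ≡.refl))) ⟩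
    sum (λ j → ind (j Fin.≟ c zero) (F (j ◂ (c ∘ suc))))
      ≈⟨ sum-δ (c zero) _ ⟩
    F (c zero ◂ (c ∘ suc))
      ≈⟨ ext (◂-η c) ⟩
    F c ∎

  -- Double counting of the pairs (x , y) with y ≗ φ x, equivalently x ≗ ψ y.
  ∑→-bijection : ∀ m {n} m′ {n′} {P : (Fin m → Fin n) → Set} {Q : (Fin m′ → Fin n′) → Set}
    (P? : Decidable P) (Q? : Decidable Q) (F : (Fin m → Fin n) → A) (G : (Fin m′ → Fin n′) → A)
    (φ : (Fin m → Fin n) → (Fin m′ → Fin n′)) (ψ : (Fin m′ → Fin n′) → (Fin m → Fin n)) →
    (∀ {x x′} → x ≗ x′ → P x → P x′) → (∀ {y y′} → y ≗ y′ → Q y → Q y′) →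
    (∀ {y y′} → y ≗ y′ → ψ y ≗ ψ y′) → (∀ {x x′} → x ≗ x′ → φ x ≗ φ x′) →
    (∀ {x} → P x → Q (φ x) × ψ (φ x) ≗ x) → (∀ {y} → Q y → P (ψ y) × φ (ψ y) ≗ y) →
    Extensional G → (∀ {x} → P x → F x ≈ G (φ x)) →
    ∑→ m n (λ x → ind (P? x) (F x)) ≈ ∑→ m′ n′ (λ y → ind (Q? y) (G y))
  ∑→-bijection m {n} m′ {n′} {P} {Q} P? Q? F G φ ψ P-≗ Q-≗ ψ-≗ φ-≗ to from G-ext F≈G = begin
    ∑→ m n (λ x → ind (P? x) (F x))
      ≈⟨ (∑→-cong m λ x → trans (ind-cong (P? x) (P? x) (λ p → p) (λ p → p) λ p _ → F≈G p)
            (sym (∑→-δ m′ (φ x) λ eq → ind-congˡ (P? x) (G-ext eq)))) ⟩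
    ∑→ m n (λ x → ∑→ m′ n′ λ y → ind (y ≗? φ x) (ind (P? x) (G y)))
      ≈⟨ (∑→-cong m λ x → ∑→-cong m′ λ y → match x y) ⟩
    ∑→ m n (λ x → ∑→ m′ n′ λ y → ind (x ≗? ψ y) (ind (Q? y) (G y)))
      ≈⟨ ∑→-comm m m′ _ ⟩
    ∑→ m′ n′ (λ y → ∑→ m n λ x → ind (x ≗? ψ y) (ind (Q? y) (G y)))
      ≈⟨ (∑→-cong m′ λ y → ∑→-δ m (ψ y) λ _ → refl) ⟩
    ∑→ m′ n′ (λ y → ind (Q? y) (G y)) ∎
    where
    match : ∀ x y → ind (y ≗? φ x) (ind (P? x) (G y)) ≈ ind (x ≗? ψ y) (ind (Q? y) (G y))
    match x y = begin
      ind (y ≗? φ x) (ind (P? x) (G y))     ≈⟨ ind-× (y ≗? φ x) (P? x) ⟩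
      ind ((y ≗? φ x) ×-dec P? x) (G y)     ≈⟨ ind-cong ((y ≗? φ x) ×-dec P? x) ((x ≗? ψ y) ×-dec Q? y)
                                                 forth back (λ _ _ → refl) ⟩
      ind ((x ≗? ψ y) ×-dec Q? y) (G y)     ≈⟨ ind-× (x ≗? ψ y) (Q? y) ⟨
      ind (x ≗? ψ y) (ind (Q? y) (G y))     ∎
      where
      forth : y ≗ φ x × P x → x ≗ ψ y × Q y
      forth (y≗ , p) = (λ i → ≡.trans (≡.sym (proj₂ (to p) i)) (≡.sym (ψ-≗ y≗ i)))
                     , Q-≗ (≡.sym ∘ y≗) (proj₁ (to p))
      back : x ≗ ψ y × Q y → y ≗ φ x × P x
      back (x≗ , q) = (λ i → ≡.trans (≡.sym (proj₂ (from q) i)) (≡.sym (φ-≗ x≗ i)))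
                    , P-≗ (≡.sym ∘ x≗) (proj₁ (from q))

  ∏ : ∀ {n} → (Fin n → A) → A
  ∏ {zero}  f = 1#
  ∏ {suc n} f = f zero * ∏ (f ∘ suc)

  ∏-cong : ∀ {n} {f g : Fin n → A} → (∀ i → f i ≈ g i) → ∏ f ≈ ∏ g
  ∏-cong {zero}  eq = refl
  ∏-cong {suc n} eq = *-cong (eq zero) (∏-cong (eq ∘ suc))

  Matrix : ℕ → Set
  Matrix n = Fin n → Fin n → A

  weight : ∀ {m n} → (Fin m → Fin n → A) → (Fin m → Fin n) → A
  weight M h = ∏ λ i → M i (h i)

  weight-ext : ∀ {m n} (M : Fin m → Fin n → A) → Extensional (weight M)
  weight-ext M eq = ∏-cong λ i → reflexive (cong (M i) (eq i))

  ham : ∀ {k} → Matrix (suc k) → A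
  ham {k} M = ∑→ (suc k) (suc k) λ π → ind (connected? rawRing π) (weight M π)

  ham-cong : ∀ {k} {M N : Matrix (suc k)} → (∀ i j → M i j ≈ N i j) → ham M ≈ ham N
  ham-cong {k} eq = ∑→-cong (suc k) λ π → ind-congˡ (connected? rawRing π) (∏-cong λ i → eq i (π i))

  -- The digraph with the edge from 0 to `suc v` contracted: the merged vertex keeps the outgoing
  -- edges of `suc v` and the incoming edges of 0, the only ones that a cycle through this edge can
  -- use.
  contractEdge : ∀ {k} → Fin (suc k) → Matrix (suc (suc k)) → Matrix (suc k)
  contractEdge v M i j = M (suc i) (expand v j)

  -- Cycles are sorted by the edge leaving 0. A loop there never reaches the second vertex, and the
  -- cycles that use a fixed edge from 0 to `suc v` correspond to the cycles of the contracted
  -- digraph.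
  ham-expand : ∀ {k} (M : Matrix (suc (suc k))) →
               ham M ≈ sum λ v → M zero (suc v) * ham (contractEdge v M)
  ham-expand {k} M = begin
    ham M
      ≈⟨ (sum-cong-≋ {suc n} λ j → ∑→-ind-* n (λ h → conn? (j ◂ h)) (M zero j) w) ⟩
    sum row
      ≈⟨ +-cong (trans (*-congˡ (∑→-0 n λ h → ind-no (conn? (zero ◂ h)) (w h) no-loop)) (zeroʳ (M zero zero)))
                (sum-cong-≋ {n} λ v → *-congˡ {M zero (suc v)} (reindex v)) ⟩
    0# + sum (λ v → M zero (suc v) * ham (contractEdge v M))
      ≈⟨ +-identityˡ _ ⟩
    sum (λ v → M zero (suc v) * ham (contractEdge v M)) ∎
    where
    n = suc k
    w : (Fin n → Fin (suc n)) → A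
    w = weight (M ∘ suc)
    conn? : ∀ {k} (π : Fin (suc k) → Fin (suc k)) → Dec (Connected π)
    conn? = connected? rawRing
    row : Fin (suc n) → A
    row j = M zero j * ∑→ n (suc n) λ h → ind (conn? (j ◂ h)) (w h)
    no-loop : ∀ {h : Fin n → Fin (suc n)} → ¬ Connected (zero ◂ h)
    no-loop {h} c = Fin.0≢1+n (≡.sym (stuck (c zero (suc zero))))
      where
      stuck : ∀ {y} → Reaches (zero ◂ h) zero y → y ≡ zero
      stuck here     = ≡.refl
      stuck (step p) = cong (zero ◂ h) (stuck p)
    reindex : ∀ v → ∑→ n (suc n) (λ h → ind (conn? (suc v ◂ h)) (w h)) ≈ ham (contractEdge v M)
    reindex v = ∑→-bijection n n (λ h → conn? (suc v ◂ h)) conn? w (weight (contractEdge v M))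
      (contract v ∘_) (expand v ∘_)
      (λ eq → connected-≗ (◂-≗ ≡.refl eq)) connected-≗
      (λ eq → cong (expand v) ∘ eq) (λ eq → cong (contract v) ∘ eq)
      (λ c → connected-contract v c , λ i → expand-contract v _ (avoids c i))
      (λ c → connected-expand v c , λ i → contract-expand v _)
      (weight-ext (contractEdge v M))
      (λ {h} c → ∏-cong λ i → reflexive (cong (M (suc i)) (≡.sym (expand-contract v (h i) (avoids c i)))))
      where
      -- `zero` is already a preimage of `suc v`, and a connected map is injective.
      avoids : ∀ {h} → Connected (suc v ◂ h) → ∀ i → h i ≢ suc v
      avoids c i e = Fin.0≢1+n (≡.sym (connected⇒injective rawRing c {suc i} {zero} e))

  ham-zero : ∀ {k} → ham {suc k} (λ _ _ → 0#) ≈ 0#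
  ham-zero {k} = trans (ham-expand {k} λ _ _ → 0#)
    (sum-0 {suc k} λ v → zeroˡ (ham (contractEdge {k} v λ _ _ → 0#)))

  -- The weighted digraph M with its vertex 0 replaced by three vertices 0, 1, 2: every edge of M
  -- into 0 is redirected to both 0 and 1, and every edge out of 0 leaves from 2.  A Hamiltonian
  -- cycle of M lifts to two cycles, traversing 0 → 1 → 2 (weight 1) or 1 → 0 → 2 (weight e y).
  gadget : ∀ {k} {X : Set} (0′ 1′ e y : X) → (Fin (suc k) → Fin (suc k) → X) →
           Fin (suc (suc (suc k))) → Fin (suc (suc (suc k))) → X
  gadget 0′ 1′ e y M zero          zero          = 0′
  gadget 0′ 1′ e y M zero          (suc zero)    = 1′
  gadget 0′ 1′ e y M zero          (suc (suc zero)) = y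
  gadget 0′ 1′ e y M zero          (suc (suc (suc _))) = 0′
  gadget 0′ 1′ e y M (suc zero)    zero          = e
  gadget 0′ 1′ e y M (suc zero)    (suc zero)    = 0′
  gadget 0′ 1′ e y M (suc zero)    (suc (suc zero)) = 1′
  gadget 0′ 1′ e y M (suc zero)    (suc (suc (suc _))) = 0′
  gadget 0′ 1′ e y M (suc (suc i)) zero          = M i zero
  gadget 0′ 1′ e y M (suc (suc i)) (suc zero)    = M i zero
  gadget 0′ 1′ e y M (suc (suc i)) (suc (suc zero)) = 0′
  gadget 0′ 1′ e y M (suc (suc i)) (suc (suc (suc j))) = M i (suc j)

  -- Contracting 0 → 1 turns the edge of weight e into a loop, which leaves only 1 → 2. Contracting
  -- 0 → 2 drops 1 → 2, since the merged vertex is entered through 0, and leaves only the edge of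
  -- weight e. In both branches the second contraction gives back `M` entry by entry.
  ham-gadget : ∀ {k} e y (M : Matrix (suc k)) →
               ham (gadget 0# 1# e y M) ≈ ham M + y * (e * ham M)
  ham-gadget {k} e y M = begin
    ham G
      ≈⟨ ham-expand G ⟩
    1# * ham G₀ + (y * ham G₁ + sum (λ v → 0# * ham (contractEdge (suc (suc v)) G)))
      ≈⟨ +-cong (trans (*-identityˡ (ham G₀)) G₀≈)
          (trans (+-cong (*-congˡ {y} G₁≈) (sum-0 {k} λ v → zeroˡ (ham (contractEdge (suc (suc v)) G))))
            (+-identityʳ (y * (e * ham M)))) ⟩
    ham M + y * (e * ham M) ∎
    where
    G  = gadget 0# 1# e y M
    G₀ = contractEdge zero G
    G₁ = contractEdge (suc zero) G
    G₀≈ : ham G₀ ≈ ham M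
    G₀≈ = begin
      ham G₀
        ≈⟨ ham-expand G₀ ⟩
      1# * ham (contractEdge zero G₀) + sum (λ v → 0# * ham (contractEdge (suc v) G₀))
        ≈⟨ +-cong (trans (*-identityˡ (ham (contractEdge zero G₀)))
                    (ham-cong {k} {contractEdge zero G₀} {M} λ { i zero → refl ; i (suc j) → refl }))
                  (sum-0 {k} λ v → zeroˡ (ham (contractEdge (suc v) G₀))) ⟩
      ham M + 0#
        ≈⟨ +-identityʳ _ ⟩
      ham M ∎
    G₁≈ : ham G₁ ≈ e * ham M
    G₁≈ = begin
      ham G₁
        ≈⟨ ham-expand G₁ ⟩
      e * ham (contractEdge zero G₁) + sum (λ v → 0# * ham (contractEdge (suc v) G₁))
        ≈⟨ +-cong (*-congˡ {e} (ham-cong {k} {contractEdge zero G₁} {M} λ { i zero → refl ; i (suc j) → refl }))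
                  (sum-0 {k} λ v → zeroˡ (ham (contractEdge (suc v) G₁))) ⟩
      e * ham M + 0#
        ≈⟨ +-identityʳ _ ⟩
      e * ham M ∎

  -- Comparison with the list sum that defines the Hamiltonian cycle polynomial

  ∑ᴸ : List A → A
  ∑ᴸ = foldr _+_ 0#

  hcSum : RawRing 0ℓ 0ℓ → ∀ n → Matrix n → A
  hcSum C n M = ∑ᴸ (map (λ π → foldr _*_ 1# (map (λ i → M i (π i)) (allFin n))) (nCycles C n))

  ∏-tabulate : ∀ {n m} (f : Fin m → A) (g : Fin n → Fin m) → foldr _*_ 1# (map f (tabulate g)) ≡ ∏ (f ∘ g)
  ∏-tabulate {zero}  f g = ≡.refl
  ∏-tabulate {suc n} f g = cong (f (g zero) *_) (∏-tabulate f (g ∘ suc))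

  ∑ᴸ-++ : ∀ {X : Set} (F : X → A) xs ys → ∑ᴸ (map F (xs ++ ys)) ≈ ∑ᴸ (map F xs) + ∑ᴸ (map F ys)
  ∑ᴸ-++ F []       ys = sym (+-identityˡ _)
  ∑ᴸ-++ F (x ∷ xs) ys = trans (+-congˡ (∑ᴸ-++ F xs ys)) (sym (+-assoc _ _ _))

  ∑ᴸ-map : ∀ {X Y : Set} {F : Y → A} {G : X → A} {f : X → Y} → (∀ x → F (f x) ≈ G x) → ∀ xs →
           ∑ᴸ (map F (map f xs)) ≈ ∑ᴸ (map G xs)
  ∑ᴸ-map eq []       = refl
  ∑ᴸ-map eq (x ∷ xs) = +-cong (eq x) (∑ᴸ-map eq xs)

  ∑ᴸ-filter : ∀ {X : Set} {P : X → Set} (P? : Decidable P) (F : X → A) xs →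
              ∑ᴸ (map F (filter P? xs)) ≈ ∑ᴸ (map (λ x → ind (P? x) (F x)) xs)
  ∑ᴸ-filter P? F []       = refl
  ∑ᴸ-filter P? F (x ∷ xs) with P? x
  ... | yes _ = +-congˡ (∑ᴸ-filter P? F xs)
  ... | no _  = trans (∑ᴸ-filter P? F xs) (sym (+-identityˡ _))

  -- `c` stands for the pattern-matching lambda inside `allFuns`. That lambda cannot be named and
  -- formally depends on j and on the accumulator, so it enters only through its pointwise values.
  ∑ᴸ-concat : ∀ {m n l} {F : (Fin (suc m) → Fin n) → A} → Extensional F →
              (c : Fin n → List (Fin (suc m) → Fin n) → (Fin m → Fin n) → Fin (suc m) → Fin n) →
              (∀ j acc h → c j acc h ≗ (j ◂ h)) →
              ∀ xs (g : Fin l → Fin n) →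
              ∑ᴸ (map F (foldr (λ j acc → map (c j acc) xs ++ acc) [] (tabulate g))) ≈
              sum {l} λ j → ∑ᴸ (map (λ h → F (g j ◂ h)) xs)
  ∑ᴸ-concat {l = zero}  ext c eq xs g = refl
  ∑ᴸ-concat {l = suc l} {F} ext c eq xs g = trans (∑ᴸ-++ F (map (c (g zero) _) xs) _)
    (+-cong (∑ᴸ-map (λ h → ext (eq (g zero) _ h)) xs) (∑ᴸ-concat ext c eq xs (g ∘ suc)))

  ∑ᴸ-allFuns : ∀ C m {n} (F : (Fin m → Fin n) → A) → Extensional F →
               ∑ᴸ (map F (allFuns C m n)) ≈ ∑→ m n F
  ∑ᴸ-allFuns C zero    F ext = trans (+-identityʳ _) (ext λ ())
  ∑ᴸ-allFuns C (suc m) {n} F ext = trans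
    (∑ᴸ-concat {m} {n} {n} {F} ext _ (λ { j _ h zero → ≡.refl ; j _ h (suc i) → ≡.refl }) (allFuns C m n) (λ j → j))
    (sum-cong-≋ {n} λ j → ∑ᴸ-allFuns C m (λ h → F (j ◂ h)) λ eq → ext (◂-≗ ≡.refl eq))

  hcSum≈ham : ∀ C k (M : Matrix (suc k)) → hcSum C (suc k) M ≈ ham M
  hcSum≈ham C k M = begin
    hcSum C n M                               ≈⟨ ∑ᴸ-filter (isNCycle? C) wt (allFuns C n n) ⟩
    ∑ᴸ (map F (allFuns C n n))                ≈⟨ ∑ᴸ-cong F G F≈G (allFuns C n n) ⟩
    ∑ᴸ (map G (allFuns C n n))                ≈⟨ ∑ᴸ-allFuns C n G G-ext ⟩
    ham M                                     ∎
    where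
    n = suc k
    wt F G : (Fin n → Fin n) → A
    wt π = foldr _*_ 1# (map (λ i → M i (π i)) (allFin n))
    F π = ind (isNCycle? C π) (wt π)
    G π = ind (connected? rawRing π) (weight M π)
    F≈G : ∀ π → F π ≈ G π
    F≈G π = ind-cong (isNCycle? C π) (connected? rawRing π)
      (isNCycle⇒connected C) (connected⇒isNCycle C)
      λ _ _ → reflexive (∏-tabulate {n} (λ i → M i (π i)) λ i → i)
    G-ext : Extensional G
    G-ext {f} {g} eq = ind-cong (connected? rawRing f) (connected? rawRing g)
      (connected-≗ eq) (connected-≗ (≡.sym ∘ eq)) λ _ _ → weight-ext M eq
    ∑ᴸ-cong : ∀ (F G : (Fin n → Fin n) → A) → (∀ x → F x ≈ G x) → ∀ xs → ∑ᴸ (map F xs) ≈ ∑ᴸ (map G xs)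
    ∑ᴸ-cong F G eq []       = refl
    ∑ᴸ-cong F G eq (x ∷ xs) = +-cong (eq x) (∑ᴸ-cong F G eq xs)

-- The field of rational functions is nontrivial

module _ (F : Field) where
  private
    module F = Field F
    C = Fraw F
    module ℙ = CommutativeRing (termRing C ⊤)
    open ℙ using (_≈_; refl; sym; trans; +-cong; *-cong; +-congˡ; +-congʳ; *-congˡ; *-congʳ; zeroˡ; zeroʳ; +-identityʳ; +-identityˡ; *-identityˡ; *-identityʳ)
    open import Algebra.Solver.Ring.NaturalCoefficients.Default ℙ.commutativeSemiring
      using (solve; _:=_; _:+_; _:*_) renaming (con to :con)
    open import Relation.Binary.Reasoning.Setoid ℙ.setoid
    P = Fε[ε] F
    ε : P
    ε = var tt

  Fraw-id : CoefHom C F.rawRing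
  Fraw-id = record
    { ⟦_⟧ = id ; ⟦⟧-cong = id ; +-homo = λ _ _ → F.refl ; *-homo = λ _ _ → F.refl
    ; -1-homo = F.refl ; 0#-homo = F.refl ; 1#-homo = F.refl }

  at : F.Carrier → P → F.Carrier
  at c = eval F.commRing id (λ _ → c)

  at-cong : ∀ c {p q} → p ≈ q → at c p F.≈ at c q
  at-cong c = eval-cong F.commRing Fraw-id (λ _ → c)

  p₀ : P → P
  p₀ p = con (at F.0# p)

  -- (p − p(0)) / ε
  Δ : P → P
  Δ (var tt) = con F.1#
  Δ (con c)  = con F.0#
  Δ (p ⊕ q)  = Δ p ⊕ Δ q
  Δ (p ⊗ q)  = Δ p ⊗ q ⊕ p₀ p ⊗ Δ q

  Δ-spec : ∀ p → p ≈ p₀ p ⊕ ε ⊗ Δ p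
  Δ-spec (var tt) = sym (trans (+-identityˡ _) (*-identityʳ _))
  Δ-spec (con c)  = sym (trans (+-congˡ (zeroʳ _)) (+-identityʳ _))
  Δ-spec (p ⊕ q)  = begin
    p ⊕ q                                          ≈⟨ +-cong (Δ-spec p) (Δ-spec q) ⟩
    (p₀ p ⊕ ε ⊗ Δ p) ⊕ (p₀ q ⊕ ε ⊗ Δ q)            ≈⟨ solve 5 (λ a a′ b b′ e →
      (a :+ e :* a′) :+ (b :+ e :* b′) := (a :+ b) :+ e :* (a′ :+ b′)) refl (p₀ p) (Δ p) (p₀ q) (Δ q) ε ⟩
    (p₀ p ⊕ p₀ q) ⊕ ε ⊗ (Δ p ⊕ Δ q)                ≈⟨ +-congʳ (con-+ _ _) ⟨
    p₀ (p ⊕ q) ⊕ ε ⊗ (Δ p ⊕ Δ q)                   ∎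
  Δ-spec (p ⊗ q)  = begin
    p ⊗ q                                          ≈⟨ *-congʳ (Δ-spec p) ⟩
    (p₀ p ⊕ ε ⊗ Δ p) ⊗ q                           ≈⟨ solve 4 (λ a a′ q e →
      (a :+ e :* a′) :* q := a :* q :+ e :* (a′ :* q)) refl (p₀ p) (Δ p) q ε ⟩
    p₀ p ⊗ q ⊕ ε ⊗ (Δ p ⊗ q)                       ≈⟨ +-congʳ (*-congˡ (Δ-spec q)) ⟩
    p₀ p ⊗ (p₀ q ⊕ ε ⊗ Δ q) ⊕ ε ⊗ (Δ p ⊗ q)        ≈⟨ solve 5 (λ a b b′ r e →
      a :* (b :+ e :* b′) :+ e :* r := a :* b :+ e :* (r :+ a :* b′)) refl (p₀ p) (p₀ q) (Δ q) (Δ p ⊗ q) ε ⟩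
    p₀ p ⊗ p₀ q ⊕ ε ⊗ Δ (p ⊗ q)                    ≈⟨ +-congʳ (con-* _ _) ⟨
    p₀ (p ⊗ q) ⊕ ε ⊗ Δ (p ⊗ q)                     ∎

  -- The product rule for `Δ` treats its factors asymmetrically, so commutativity of `⊗` is the case
  -- with content: both orders agree once the undivided factor is split by `Δ-spec`.
  Δ-cong : ∀ {p q} → p ≈ q → Δ p ≈ Δ q
  Δ-cong ~refl           = refl
  Δ-cong (~sym e)        = sym (Δ-cong e)
  Δ-cong (~trans e f)    = trans (Δ-cong e) (Δ-cong f)
  Δ-cong (⊕-cong e f)    = ⊕-cong (Δ-cong e) (Δ-cong f)
  Δ-cong (⊗-cong e f)    = ⊕-cong (⊗-cong (Δ-cong e) f) (⊗-cong (con-≈ (at-cong F.0# e)) (Δ-cong f))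
  Δ-cong (⊕-assoc a b c) = ⊕-assoc _ _ _
  Δ-cong (⊕-comm a b)    = ⊕-comm _ _
  Δ-cong (⊕-zero a)      = ⊕-zero _
  Δ-cong (⊕-inv a)       = trans (+-congˡ (trans (+-congʳ (zeroˡ _)) (+-identityˡ _))) (⊕-inv (Δ a))
  Δ-cong (⊗-assoc a b c) = begin
    (Δ a ⊗ b ⊕ p₀ a ⊗ Δ b) ⊗ c ⊕ p₀ (a ⊗ b) ⊗ Δ c      ≈⟨ +-congˡ (*-congʳ (con-* _ _)) ⟩
    (Δ a ⊗ b ⊕ p₀ a ⊗ Δ b) ⊗ c ⊕ (p₀ a ⊗ p₀ b) ⊗ Δ c   ≈⟨ solve 7 (λ a₀ a′ b b₀ b′ c c′ →
      (a′ :* b :+ a₀ :* b′) :* c :+ (a₀ :* b₀) :* c′ := a′ :* (b :* c) :+ a₀ :* (b′ :* c :+ b₀ :* c′))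
      refl (p₀ a) (Δ a) b (p₀ b) (Δ b) c (Δ c) ⟩
    Δ a ⊗ (b ⊗ c) ⊕ p₀ a ⊗ (Δ b ⊗ c ⊕ p₀ b ⊗ Δ c)      ∎
  Δ-cong (⊗-comm a b)    = begin
    Δ a ⊗ b ⊕ p₀ a ⊗ Δ b                   ≈⟨ +-congʳ (*-congˡ (Δ-spec b)) ⟩
    Δ a ⊗ (p₀ b ⊕ ε ⊗ Δ b) ⊕ p₀ a ⊗ Δ b    ≈⟨ solve 5 (λ a₀ a′ b₀ b′ e →
      a′ :* (b₀ :+ e :* b′) :+ a₀ :* b′ := b′ :* (a₀ :+ e :* a′) :+ b₀ :* a′)
      refl (p₀ a) (Δ a) (p₀ b) (Δ b) ε ⟩
    Δ b ⊗ (p₀ a ⊕ ε ⊗ Δ a) ⊕ p₀ b ⊗ Δ a    ≈⟨ +-congʳ (*-congˡ (Δ-spec a)) ⟨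
    Δ b ⊗ a ⊕ p₀ b ⊗ Δ a                   ∎
  Δ-cong (⊗-one a)       = trans (+-cong (*-identityʳ _) (zeroʳ _)) (+-identityʳ _)
  Δ-cong (distrib a b c) = solve 6 (λ a₀ a′ b b′ c c′ →
      a′ :* (b :+ c) :+ a₀ :* (b′ :+ c′) := (a′ :* b :+ a₀ :* b′) :+ (a′ :* c :+ a₀ :* c′))
      refl (p₀ a) (Δ a) b (Δ b) c (Δ c)
  Δ-cong (con-≈ e)       = refl
  Δ-cong (con-+ x y)     = sym (+-identityʳ _)
  Δ-cong (con-* x y)     = sym (trans (+-cong (zeroˡ _) (zeroʳ _)) (+-identityʳ _))

  -- `Δ` is well defined on the quotient and divides by ε, so it is applied to both sides.
  ε-cancel : ∀ {p} → ε ⊗ p ≈ con F.0# → p ≈ con F.0#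
  ε-cancel {p} e = trans (sym (trans (+-cong (*-identityˡ p) (zeroˡ _)) (+-identityʳ p))) (Δ-cong e)

  -- Coefficient lists give the zero-product argument something to recurse on. Trailing zeros are
  -- allowed, since without decidable equality in F they cannot be stripped.
  horner : List F.Carrier → P
  horner []       = con F.0#
  horner (c ∷ cs) = con c ⊕ ε ⊗ horner cs

  HasHorner : P → Set
  HasHorner p = ∃ λ cs → p ≈ horner cs

  horner-+ : ∀ cs ds → HasHorner (horner cs ⊕ horner ds)
  horner-+ []       ds       = ds , +-identityˡ _
  horner-+ (c ∷ cs) []       = c ∷ cs , +-identityʳ _
  horner-+ (c ∷ cs) (d ∷ ds) with horner-+ cs ds
  ... | es , eq = c F.+ d ∷ es , (begin
    (con c ⊕ ε ⊗ horner cs) ⊕ (con d ⊕ ε ⊗ horner ds)    ≈⟨ solve 5 (λ a a′ b b′ e →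
      (a :+ e :* a′) :+ (b :+ e :* b′) := (a :+ b) :+ e :* (a′ :+ b′))
      refl (con c) (horner cs) (con d) (horner ds) ε ⟩
    (con c ⊕ con d) ⊕ ε ⊗ (horner cs ⊕ horner ds)        ≈⟨ +-cong (sym (con-+ c d)) (*-congˡ eq) ⟩
    con (c F.+ d) ⊕ ε ⊗ horner es                        ∎)

  horner-scale : ∀ x cs → con x ⊗ horner cs ≈ horner (map (x F.*_) cs)
  horner-scale x []       = zeroʳ _
  horner-scale x (c ∷ cs) = begin
    con x ⊗ (con c ⊕ ε ⊗ horner cs)              ≈⟨ solve 4 (λ x c r e →
      x :* (c :+ e :* r) := x :* c :+ e :* (x :* r)) refl (con x) (con c) (horner cs) ε ⟩
    con x ⊗ con c ⊕ ε ⊗ (con x ⊗ horner cs)      ≈⟨ +-cong (sym (con-* x c)) (*-congˡ (horner-scale x cs)) ⟩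
    con (x F.* c) ⊕ ε ⊗ horner (map (x F.*_) cs) ∎

  horner-* : ∀ cs ds → HasHorner (horner cs ⊗ horner ds)
  horner-* []       ds = [] , zeroˡ _
  horner-* (c ∷ cs) ds with horner-* cs ds
  ... | es , eq with horner-+ (map (c F.*_) ds) (F.0# ∷ es)
  ... | fs , eq′ = fs , (begin
    (con c ⊕ ε ⊗ horner cs) ⊗ horner ds                        ≈⟨ solve 4 (λ c r d e →
      (c :+ e :* r) :* d := c :* d :+ e :* (r :* d)) refl (con c) (horner cs) (horner ds) ε ⟩
    con c ⊗ horner ds ⊕ ε ⊗ (horner cs ⊗ horner ds)            ≈⟨ +-cong (horner-scale c ds)
                                                                    (trans (*-congˡ eq) (sym (+-identityˡ _))) ⟩
    horner (map (c F.*_) ds) ⊕ (con F.0# ⊕ ε ⊗ horner es)      ≈⟨ eq′ ⟩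
    horner fs                                                  ∎)

  hasHorner : ∀ p → HasHorner p
  hasHorner (var tt) = F.0# ∷ F.1# ∷ [] ,
    sym (trans (+-identityˡ _) (trans (*-congˡ (trans (+-congˡ (zeroʳ _)) (+-identityʳ _))) (*-identityʳ _)))
  hasHorner (con c)  = c ∷ [] , sym (trans (+-congˡ (zeroʳ _)) (+-identityʳ _))
  hasHorner (p ⊕ q) with hasHorner p | hasHorner q
  ... | cs , e | ds , f with horner-+ cs ds
  ... | es , g = es , trans (+-cong e f) g
  hasHorner (p ⊗ q) with hasHorner p | hasHorner q
  ... | cs , e | ds , f with horner-* cs ds
  ... | es , g = es , trans (*-cong e f) g

  -- An inverse of x is available only once x ≈ 0 is refuted. Under the assumption `k` that neither
  -- factor vanishes this refutation is at hand.
  field-domain : ∀ {x y} → x F.* y F.≈ F.0# → ¬ ¬ (x F.≈ F.0# ⊎ y F.≈ F.0#)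
  field-domain {x} {y} xy≈0 k = k (inj₂ y≈0)
    where
    x≉0 : ¬ x F.≈ F.0#
    x≉0 = k ∘ inj₁
    y≈0 : y F.≈ F.0#
    y≈0 with F.inverse x x≉0
    ... | z , xz≈1 = F.trans (F.sym (F.*-identityˡ y)) (F.trans (F.*-congʳ (F.sym xz≈1))
            (F.trans (F.*-congʳ (F.*-comm x z)) (F.trans (F.*-assoc z x y)
            (F.trans (F.*-congˡ xy≈0) (F.zeroʳ z)))))

  ZeroProduct : P → P → Set
  ZeroProduct p q = p ⊗ q ≈ con F.0# → ¬ ¬ (p ≈ con F.0# ⊎ q ≈ con F.0#)

  -- The constant terms multiply to 0, so one of them vanishes. That factor is then ε times its
  -- tail, ε is cancelled, and the hypothesis for the tail applies.
  zeroProduct-∷ : ∀ c cs d ds → let p = horner (c ∷ cs) ; q = horner (d ∷ ds) in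
                  ZeroProduct (horner cs) q → ZeroProduct p (horner ds) → ZeroProduct p q
  zeroProduct-∷ c cs d ds ihˡ ihʳ e k = field-domain cd≈0 λ
    { (inj₁ c≈0) → ihˡ
        (ε-cancel (trans (sym (ℙ.*-assoc ε p′ q)) (trans (*-congʳ (sym (shift cs c≈0))) e)))
        λ { (inj₁ z) → k (inj₁ (trans (shift cs c≈0) (trans (*-congˡ z) (zeroʳ ε)))) ; (inj₂ z) → k (inj₂ z) }
    ; (inj₂ d≈0) → ihʳ
        (ε-cancel (trans (solve 3 (λ x p q → x :* (p :* q) := p :* (x :* q)) refl ε p q′)
          (trans (*-congˡ (sym (shift ds d≈0))) e)))
        λ { (inj₁ z) → k (inj₁ z) ; (inj₂ z) → k (inj₂ (trans (shift ds d≈0) (trans (*-congˡ z) (zeroʳ ε)))) } }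
    where
    p = horner (c ∷ cs)
    q = horner (d ∷ ds)
    p′ = horner cs
    q′ = horner ds
    shift : ∀ {x} xs → x F.≈ F.0# → horner (x ∷ xs) ≈ ε ⊗ horner xs
    shift xs x≈0 = trans (+-congʳ (con-≈ x≈0)) (+-identityˡ _)
    at₀ : ∀ x xs → at F.0# (horner (x ∷ xs)) F.≈ x
    at₀ x xs = F.trans (F.+-congˡ (F.zeroˡ _)) (F.+-identityʳ x)
    cd≈0 : c F.* d F.≈ F.0#
    cd≈0 = F.trans (F.sym (F.*-cong (at₀ c cs) (at₀ d ds))) (at-cong F.0# e)

  horner-domain : ∀ cs ds → ZeroProduct (horner cs) (horner ds)
  horner-domain []       ds       e k = k (inj₁ refl)
  horner-domain (c ∷ cs) []       e k = k (inj₂ refl)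
  horner-domain (c ∷ cs) (d ∷ ds) =
    zeroProduct-∷ c cs d ds (horner-domain cs (d ∷ ds)) (horner-domain (c ∷ cs) ds)

  domain : ∀ {p q} → ZeroProduct p q
  domain {p} {q} e k with hasHorner p | hasHorner q
  ... | cs , f | ds , g = horner-domain cs ds (trans (sym (*-cong f g)) e)
    λ { (inj₁ z) → k (inj₁ (trans f z)) ; (inj₂ z) → k (inj₂ (trans g z)) }

  1≉0 : ¬ (con F.1# ≈ con F.0#)
  1≉0 e = F.0≉1 (F.sym (at-cong F.0# e))

  ε≉0 : ¬ (ε ≈ con F.0#)
  ε≉0 e = F.0≉1 (F.sym (at-cong F.1# e))

  *≉0 : ∀ {p q} → ¬ (p ≈ con F.0#) → ¬ (q ≈ con F.0#) → ¬ (p ⊗ q ≈ con F.0#)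
  *≉0 p≉0 q≉0 e = domain e λ { (inj₁ z) → p≉0 z ; (inj₂ z) → q≉0 z }

  cancelˡ : ∀ {p q r} → ¬ (p ≈ con F.0#) → p ⊗ q ≈ p ⊗ r → ¬ ¬ (q ≈ r)
  cancelˡ {p} {q} {r} p≉0 e k = domain {p} {q ⊕ (ℙ.- r)} diff λ { (inj₁ z) → p≉0 z ; (inj₂ z) → k (q≈r z) }
    where
    open import Algebra.Properties.Ring ℙ.ring using (-‿distribʳ-*)
    open import Algebra.Properties.Group ℙ.+-group using (x∙y⁻¹≈ε⇒x≈y)
    diff : p ⊗ (q ⊕ (ℙ.- r)) ≈ con F.0#
    diff = trans (distrib _ _ _) (trans (+-cong e (sym (-‿distribʳ-* p r))) (ℙ.-‿inverseʳ _))
    q≈r : q ⊕ (ℙ.- r) ≈ con F.0# → q ≈ r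
    q≈r = x∙y⁻¹≈ε⇒x≈y q r

  prodD-++ : ∀ xs ys → prodD F (xs ++ ys) ≈ prodD F xs ⊗ prodD F ys
  prodD-++ []       ys = sym (*-identityˡ _)
  prodD-++ (x ∷ xs) ys = trans (*-congˡ (prodD-++ xs ys)) (sym (ℙ.*-assoc _ _ _))

  prodD≉0 : ∀ xs → ¬ (prodD F xs ≈ con F.0#)
  prodD≉0 []               = 1≉0
  prodD≉0 ((q , q≉0) ∷ xs) = *≉0 q≉0 (prodD≉0 xs)

  -- Terms over F(ε) as fractions

  module _ {V : Set} where
    private
      T = Term (RatRaw F) V

    -- The value of a term with all variables set to 0, kept as an unreduced fraction. `eval` would
    -- need `RatRaw` to be a commutative ring, so numerator and denominator are computed directly in
    -- F[ε].
    numer denom : T → P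
    numer (var v) = con F.0#
    numer (con x) = Frac.num x
    numer (a ⊕ b) = numer a ⊗ denom b ⊕ numer b ⊗ denom a
    numer (a ⊗ b) = numer a ⊗ numer b
    denom (var v) = con F.1#
    denom (con x) = prodD F (Frac.den x)
    denom (a ⊕ b) = denom a ⊗ denom b
    denom (a ⊗ b) = denom a ⊗ denom b

    denom≉0 : ∀ a → ¬ (denom a ≈ con F.0#)
    denom≉0 (var v) = 1≉0
    denom≉0 (con x) = prodD≉0 (Frac.den x)
    denom≉0 (a ⊕ b) = *≉0 (denom≉0 a) (denom≉0 b)
    denom≉0 (a ⊗ b) = *≉0 (denom≉0 a) (denom≉0 b)

    -- F is not assumed to have stable equality, so F[ε] is an integral domain, and
    -- cross-multiplication transitive, only up to double negation.
    cross : ∀ {a b} → _~_ (RatRaw F) a b → ¬ ¬ (numer a ⊗ denom b ≈ numer b ⊗ denom a)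
    cross ~refl k = k refl
    cross (~sym e) k = cross e (k ∘ sym)
    cross (~trans {a} {b} {c} e f) k = cross e λ e′ → cross f λ f′ → cancelˡ (denom≉0 b) (begin
      denom b ⊗ (numer a ⊗ denom c)    ≈⟨ solve 3 (λ d n x → d :* (n :* x) := (n :* d) :* x) refl (denom b) (numer a) (denom c) ⟩
      (numer a ⊗ denom b) ⊗ denom c    ≈⟨ *-congʳ e′ ⟩
      (numer b ⊗ denom a) ⊗ denom c    ≈⟨ solve 3 (λ n x y → (n :* x) :* y := (n :* y) :* x) refl (numer b) (denom a) (denom c) ⟩
      (numer b ⊗ denom c) ⊗ denom a    ≈⟨ *-congʳ f′ ⟩
      (numer c ⊗ denom b) ⊗ denom a    ≈⟨ solve 3 (λ n d x → (n :* d) :* x := d :* (n :* x)) refl (numer c) (denom b) (denom a) ⟩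
      denom b ⊗ (numer c ⊗ denom a)    ∎) k
    cross (⊕-cong {a} {b} {c} {d} e f) k = cross e λ e′ → cross f λ f′ → k (begin
      (numer a ⊗ denom c ⊕ numer c ⊗ denom a) ⊗ (denom b ⊗ denom d)
        ≈⟨ solve 6 (λ na da db nc dc dd → (na :* dc :+ nc :* da) :* (db :* dd) :=
             (na :* db) :* (dc :* dd) :+ (nc :* dd) :* (da :* db))
             refl (numer a) (denom a) (denom b) (numer c) (denom c) (denom d) ⟩
      (numer a ⊗ denom b) ⊗ (denom c ⊗ denom d) ⊕ (numer c ⊗ denom d) ⊗ (denom a ⊗ denom b)
        ≈⟨ +-cong (*-congʳ e′) (*-congʳ f′) ⟩
      (numer b ⊗ denom a) ⊗ (denom c ⊗ denom d) ⊕ (numer d ⊗ denom c) ⊗ (denom a ⊗ denom b)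
        ≈⟨ solve 6 (λ nb da db nd dc dd → (nb :* da) :* (dc :* dd) :+ (nd :* dc) :* (da :* db) :=
             (nb :* dd :+ nd :* db) :* (da :* dc))
             refl (numer b) (denom a) (denom b) (numer d) (denom c) (denom d) ⟩
      (numer b ⊗ denom d ⊕ numer d ⊗ denom b) ⊗ (denom a ⊗ denom c) ∎)
    cross (⊗-cong {a} {b} {c} {d} e f) k = cross e λ e′ → cross f λ f′ → k (begin
      (numer a ⊗ numer c) ⊗ (denom b ⊗ denom d)    ≈⟨ interchange _ _ _ _ ⟩
      (numer a ⊗ denom b) ⊗ (numer c ⊗ denom d)    ≈⟨ *-cong e′ f′ ⟩
      (numer b ⊗ denom a) ⊗ (numer d ⊗ denom c)    ≈⟨ interchange _ _ _ _ ⟩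
      (numer b ⊗ numer d) ⊗ (denom a ⊗ denom c)    ∎)
      where
      open import Algebra.Properties.CommutativeSemigroup ℙ.*-commutativeSemigroup using (interchange)
    cross (⊕-assoc a b c) k = k (solve 6 (λ na da nb db nc dc →
      ((na :* db :+ nb :* da) :* dc :+ nc :* (da :* db)) :* (da :* (db :* dc)) :=
      (na :* (db :* dc) :+ (nb :* dc :+ nc :* db) :* da) :* ((da :* db) :* dc))
      refl (numer a) (denom a) (numer b) (denom b) (numer c) (denom c))
    cross (⊕-comm a b) k = k (solve 4 (λ na da nb db →
      (na :* db :+ nb :* da) :* (db :* da) := (nb :* da :+ na :* db) :* (da :* db))
      refl (numer a) (denom a) (numer b) (denom b))
    cross (⊕-zero a) k = k (solve 2 (λ na da →
      (na :* :con 1 :+ :con 0 :* da) :* da := na :* (da :* :con 1)) refl (numer a) (denom a))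
    cross (⊕-inv a) k = k (trans (*-identityʳ _) (trans (+-cong
      (solve 2 (λ na da → na :* (:con 1 :* da) := da :* na) refl (numer a) (denom a))
      (solve 3 (λ m na da → (m :* :con 1) :* na :* da := m :* (da :* na)) refl (con (F.- F.1#)) (numer a) (denom a)))
      (trans (⊕-inv _) (sym (zeroˡ _)))))
    cross (⊗-assoc a b c) k = k (solve 6 (λ na da nb db nc dc →
      (na :* nb) :* nc :* (da :* (db :* dc)) := na :* (nb :* nc) :* ((da :* db) :* dc))
      refl (numer a) (denom a) (numer b) (denom b) (numer c) (denom c))
    cross (⊗-comm a b) k = k (*-cong (ℙ.*-comm _ _) (ℙ.*-comm _ _))
    cross (⊗-one a) k = k (solve 2 (λ na da →
      (na :* :con 1) :* da := na :* (da :* :con 1)) refl (numer a) (denom a))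
    cross (distrib a b c) k = k (solve 6 (λ na da nb db nc dc →
      na :* (nb :* dc :+ nc :* db) :* ((da :* db) :* (da :* dc)) :=
      ((na :* nb) :* (da :* dc) :+ (na :* nc) :* (da :* db)) :* (da :* (db :* dc)))
      refl (numer a) (denom a) (numer b) (denom b) (numer c) (denom c))
    cross (con-≈ e) k = k e
    cross (con-+ x y) k = k (*-congˡ (sym (prodD-++ (Frac.den x) (Frac.den y))))
    cross (con-* x y) k = k (*-congˡ (sym (prodD-++ (Frac.den x) (Frac.den y))))

    Rat-1≉0 : ¬ (_~_ (RatRaw F) {V} (con (RawRing.1# (RatRaw F))) (con (RawRing.0# (RatRaw F))))
    Rat-1≉0 e = cross e λ e′ → 1≉0 (trans (sym (*-identityʳ _)) (trans e′ (zeroˡ _)))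

-- Projections as oracle circuits

module _ (C : RawRing 0ℓ 0ℓ) {N : ℕ} where
  open Circuits using (inp; cst; orc; []; _▷_)

  -- One leaf per variable of the oracle, followed by a single oracle gate.
  projection⇒oracle : ∀ {b} {p : Term C (Fin N)} {g : Term C (Fin b)} →
                      _≤proj_ C p g → OracleSize≤ C g p (suc b)
  projection⇒oracle {b} {p} {g} (σ , p~) =
    b , (leafSLP σ ▷ orc tt id) , ℕ.≤-refl ,
    ~trans (≡.subst (_~_ C _) (subst-ext (lookup-leaf σ) g) ~refl) (~sym p~)
    where
    open WithOracle C N g using (SLP; Gate; values)
    leafGate : ∀ {k} → Fin N ⊎ RawRing.Carrier C → Gate k
    leafGate (inj₁ i) = inp i
    leafGate (inj₂ c) = cst c
    leafSLP : ∀ {k} → (Fin k → Fin N ⊎ RawRing.Carrier C) → SLP k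
    leafSLP {zero}  σ = []
    leafSLP {suc k} σ = leafSLP (σ ∘ suc) ▷ leafGate (σ zero)
    lookup-leaf : ∀ {k} (σ : Fin k → Fin N ⊎ RawRing.Carrier C) i →
                  lookup (values (leafSLP σ)) i ≡ projSubst C σ i
    lookup-leaf σ zero with σ zero
    ... | inj₁ _ = ≡.refl
    ... | inj₂ _ = ≡.refl
    lookup-leaf σ (suc i) = ≡.trans (lookup-leaf (σ ∘ suc) i)
      (≡.trans (projSubst≡toTerm (σ ∘ suc) i) (≡.sym (projSubst≡toTerm σ (suc i))))

≡⇒~ : ∀ {C : RawRing 0ℓ 0ℓ} {V : Set} {a b : Term C V} → a ≡ b → _~_ C a b
≡⇒~ ≡.refl = ~refl

subst-var : ∀ {C : RawRing 0ℓ 0ℓ} {V : Set} (a : Term C V) → subst C var a ≡ a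
subst-var (var v) = ≡.refl
subst-var (con c) = ≡.refl
subst-var (a ⊕ b) = cong₂ _⊕_ (subst-var a) (subst-var b)
subst-var (a ⊗ b) = cong₂ _⊗_ (subst-var a) (subst-var b)

-- Coefficient embeddings into F(ε) and the inverse of ε

module _ (F : Field) where
  private
    module F = Field F
    C = Fraw F
    P = PolyRaw F
    R = RatRaw F
    module P = RawRing P
    module R = RawRing R
    module ℙ = CommutativeRing (termRing C ⊤)

  toPoly : CoefHom C P
  toPoly = con-hom (Fraw-id F) ⊤

  fromField : CoefHom C R
  fromField = record
    { ⟦_⟧ = ιF F
    ; ⟦⟧-cong = λ e → ℙ.*-congʳ (con-≈ e)
    ; +-homo = λ x y → ℙ.*-congʳ (ℙ.trans (con-+ x y)
        (ℙ.sym (ℙ.+-cong (ℙ.*-identityʳ (con x)) (ℙ.*-identityʳ (con y)))))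
    ; *-homo = λ x y → ℙ.*-congʳ (con-* x y)
    ; -1-homo = ℙ.*-congʳ (ℙ.sym (⊗-one _)) ; 0#-homo = ℙ.refl ; 1#-homo = ℙ.refl }

  mapP : ∀ {V : Set} → Term C V → Term P V
  mapP = mapCoef con

  mapR : ∀ {V : Set} → Term C V → Term R V
  mapR = mapCoef (ιF F)

  mapPR : ∀ {V : Set} → Term P V → Term R V
  mapPR = mapCoef (ιP F)

  mapPR-mapP : ∀ {V : Set} (a : Term C V) → mapPR (mapP a) ≡ mapR a
  mapPR-mapP = mapCoef-∘ {C} {P} {R} (ιP F) con

  ε⁻¹ -ε⁻¹ : R.Carrier
  ε⁻¹  = con F.1# // ((var tt , ε≉0 F) ∷ [])
  -ε⁻¹ = con (F.- F.1#) // ((var tt , ε≉0 F) ∷ [])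

  module _ {V : Set} where
    private
      module T = CommutativeRing (termRing R V)
      ε : Term R V
      ε = con (εR F)

    ε-inverse : ε ⊗ con ε⁻¹ T.≈ con R.1#
    ε-inverse = ~trans (~sym (con-* _ _)) (con-≈ (⊗-comm _ _))

    1-ε⁻¹ε : con R.1# ⊕ (con -ε⁻¹ ⊗ ε) T.≈ con R.0#
    1-ε⁻¹ε = T.trans (T.+-congˡ (T.trans (~sym (con-* _ _)) (T.trans (con-≈
        (ℙ.trans (⊗-one _) (ℙ.*-cong (ℙ.sym (⊗-one _)) (ℙ.sym (⊗-one _))))) (~sym (⊗-one _)))))
      (⊕-inv _)

  -- Density of the complete families

  -- `plusEps` identifies variables by index, so those of f come first, in their own positions. Then
  -- follow z and a fresh copy of the variables of K.
  completing : Fam C → Fam C → Fam P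
  completing f K = record
    { nv  = λ n → nv f n ℕ.+ suc (nv K n)
    ; pol = λ n → var (nv f n ↑ʳ zero) ⊗
        (rename P (λ j → nv f n ↑ʳ suc j) (mapP (pol K n)) ⊕
         (con (P.- P.1#) ⊗ rename P (_↑ˡ suc (nv K n)) (mapP (pol f n)))) }

  completing-pFam : ∀ {f K} → PFam C f → PFam C K → PFam P (completing f K)
  completing-pFam {f} {K} (nf , df , pdf , tf) (nK , dK , pdK , tK) =
    polyBounded-+ nf (polyBounded-+ (polyBounded-const 1) nK) ,
    (λ n → suc (dK n ℕ.+ df n)) , polyBounded-+ (polyBounded-const 1) (polyBounded-+ pdK pdf) ,
    λ n → let (a , a~ , degA) = tf n ; (b , b~ , degB) = tK n in
      var (nv f n ↑ʳ zero) ⊗ (rename P (λ j → nv f n ↑ʳ suc j) (mapP b) ⊕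
        (con (P.- P.1#) ⊗ rename P (_↑ˡ suc (nv K n)) (mapP a))) ,
      ⊗-cong ~refl (⊕-cong (subst-cong _ (mapCoef-cong toPoly b~))
        (⊗-cong ~refl (subst-cong _ (mapCoef-cong toPoly a~)))) ,
      s≤s (ℕ.⊔-lub
        (ℕ.≤-trans (ℕ.≤-reflexive (deg-embed _ b)) (ℕ.≤-trans degB (ℕ.m≤m+n _ _)))
        (ℕ.≤-trans (ℕ.≤-reflexive (deg-embed _ a)) (ℕ.≤-trans degA (ℕ.m≤n+m _ _))))
    where
    deg-embed : ∀ {V W : Set} (ρ : V → W) (a : Term C V) → deg P (rename P ρ (mapP a)) ≡ deg C a
    deg-embed ρ a = ≡.trans (deg-rename ρ (mapP a)) (deg-mapCoef {C} {P} con a)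

  -- At z = 1/ε the polynomial f(x) + ε z (K(y) − f(x)) becomes K(y), whatever x is.
  completing-projection : ∀ f K n → _≤proj_ R (mapR (pol K n)) (pol (plusEps F f (completing f K)) n)
  completing-projection f K n = σ , T.sym (begin
    subst R σ′ (pol (plusEps F f g) n)
      ≈⟨ T.+-cong (≡⇒~ f-part) (T.*-congˡ (T.*-cong (≡⇒~ z-part)
           (T.+-cong (≡⇒~ K-part) (T.*-congˡ {con (R.- R.1#)} (≡⇒~ f-part′))))) ⟩
    f′ ⊕ con (εR F) ⊗ (con ε⁻¹ ⊗ (K′ ⊕ (con (R.- R.1#) ⊗ f′)))
      ≈⟨ T.+-congˡ (T.trans (T.sym (⊗-assoc _ _ _)) (T.trans (T.*-congʳ ε-inverse) (T.*-identityˡ _))) ⟩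
    f′ ⊕ (K′ ⊕ (con (R.- R.1#) ⊗ f′))
      ≈⟨ T.trans (T.+-congˡ (⊕-comm _ _)) (T.sym (⊕-assoc _ _ _)) ⟩
    (f′ ⊕ (con (R.- R.1#) ⊗ f′)) ⊕ K′
      ≈⟨ T.trans (T.+-congʳ (⊕-inv f′)) (T.+-identityˡ K′) ⟩
    K′ ∎)
    where
    module T = CommutativeRing (termRing R (Fin (nv K n)))
    open import Relation.Binary.Reasoning.Setoid T.setoid
    g = completing f K
    a = nv f n
    b = nv g n
    a≤b : a ℕ.≤ b
    a≤b = ℕ.m≤m+n a _
    ρf : Fin a → Fin (a ℕ.⊔ b)
    ρf i = inject≤ i (ℕ.m≤m⊔n a b)
    ρg : Fin b → Fin (a ℕ.⊔ b)
    ρg i = inject≤ i (ℕ.m≤n⊔m a b)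
    assign : Fin a ⊎ Fin (suc (nv K n)) → Fin (nv K n) ⊎ R.Carrier
    assign (inj₁ _)       = inj₂ R.0#
    assign (inj₂ zero)    = inj₂ ε⁻¹
    assign (inj₂ (suc j)) = inj₁ j
    σ : Fin (a ℕ.⊔ b) → Fin (nv K n) ⊎ R.Carrier
    σ i = assign (splitAt a (cast (ℕ.m≤n⇒m⊔n≡n a≤b) i))
    σ′ = projSubst R σ
    σ-ρg : ∀ i → σ′ (ρg i) ≡ toTerm (assign (splitAt a i))
    σ-ρg i = ≡.trans (projSubst≡toTerm σ (ρg i)) (cong (toTerm ∘ assign ∘ splitAt a)
      (Fin.toℕ-injective (≡.trans (Fin.toℕ-cast _ (ρg i)) (Fin.toℕ-inject≤ i (ℕ.m≤n⊔m a b)))))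
    ρf≡ρg : ∀ i → ρf i ≡ ρg (i ↑ˡ suc (nv K n))
    ρf≡ρg i = Fin.toℕ-injective (≡.trans (Fin.toℕ-inject≤ i _)
      (≡.sym (≡.trans (Fin.toℕ-inject≤ (i ↑ˡ _) (ℕ.m≤n⊔m a b)) (Fin.toℕ-↑ˡ i _))))
    f′ = subst R (σ′ ∘ ρf) (mapR (pol f n))
    K′ = mapR (pol K n)
    f-part : subst R σ′ (rename R ρf (mapR (pol f n))) ≡ f′
    f-part = subst-subst σ′ _ (mapR (pol f n))
    renamed : ∀ {m} (ρ : Fin m → Fin b) (p : Term C (Fin m)) →
              subst R σ′ (rename R ρg (mapPR (rename P ρ (mapP p)))) ≡ subst R (σ′ ∘ ρg ∘ ρ) (mapR p)
    renamed ρ p = ≡.trans (subst-subst σ′ _ (mapPR (rename P ρ (mapP p)))) (≡.trans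
      (cong (subst R (σ′ ∘ ρg)) (≡.trans (mapCoef-subst {P} {R} (ιP F) _ (mapP p)) (cong (rename R ρ) (mapPR-mapP p))))
      (subst-subst (σ′ ∘ ρg) _ (mapR p)))
    f-part′ : subst R σ′ (rename R ρg (mapPR (rename P (_↑ˡ suc (nv K n)) (mapP (pol f n))))) ≡ f′
    f-part′ = ≡.trans (renamed (_↑ˡ suc (nv K n)) (pol f n))
      (subst-ext (λ i → cong σ′ (≡.sym (ρf≡ρg i))) (mapR (pol f n)))
    z-part : σ′ (ρg (a ↑ʳ zero)) ≡ con ε⁻¹
    z-part = ≡.trans (σ-ρg (a ↑ʳ zero)) (cong (toTerm ∘ assign) (Fin.splitAt-↑ʳ a _ zero))
    K-part : subst R σ′ (rename R ρg (mapPR (rename P (λ j → a ↑ʳ suc j) (mapP (pol K n))))) ≡ K′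
    K-part = ≡.trans (renamed (λ j → a ↑ʳ suc j) (pol K n)) (≡.trans
      (subst-ext (λ j → ≡.trans (σ-ρg (a ↑ʳ suc j)) (cong (toTerm ∘ assign) (Fin.splitAt-↑ʳ a _ (suc j)))) K′)
      (subst-var K′))

  -- One exact projection serves all four reductions: it is a border projection with error term 0,
  -- and a single oracle gate fed by leaves turns either kind of projection into an oracle circuit.
  dense-complete : ∀ ⪯ f K → PFam C f → PFam C K → Reduces F ⪯ (embF F K) (plusEps F f (completing f K))
  dense-complete ⪯ f K Pf PK = reduce ⪯
    where
    h = plusEps F f (completing f K)
    size : ℕ → ℕ
    size n = suc (nv h n)
    size-bounded : PolyBounded size
    size-bounded = polyBounded-+ (polyBounded-const 1) (polyBounded-≤ (λ n → ℕ.m⊔n≤m+n (nv f n) _)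
      (polyBounded-+ (proj₁ Pf) (proj₁ (completing-pFam {f} {K} Pf PK))))
    border : ∀ n → _≤proj_ R (pol (embF F K) n ⊕ (con (εR F) ⊗ mapPR (con P.0#))) (pol h n)
    border n with completing-projection f K n
    ... | σ , e = σ , ~trans (~trans (⊕-cong ~refl (CommutativeRing.zeroʳ (termRing R _) _)) (⊕-zero _)) e
    reduce : ∀ ⪯ → Reduces F ⪯ (embF F K) h
    reduce ≤p-red = id , polyBounded-id , completing-projection f K
    reduce ≤c-red = id , polyBounded-id , size , size-bounded ,
      λ n → projection⇒oracle R (completing-projection f K n)
    reduce ⊴p-red = id , polyBounded-id , λ n → con P.0# , border n
    reduce ⊴c-red = id , polyBounded-id , size , size-bounded ,
      λ n → con P.0# , projection⇒oracle R (border n)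

  -- The perturbation f · ∏ (1 + ε x)

  module _ {V : Set} where

    -- perturb p vs = p · ∏ (1 + ε v), the product over vs, in a form computable by skew circuits.
    perturb : Term R V → List V → Term R V
    perturb p []       = p
    perturb p (v ∷ vs) = perturb p vs ⊕ (var v ⊗ (con (εR F) ⊗ perturb p vs))

    -- ∏ (1 + ε v) = 1 + ε · perturbation vs
    perturbation : List V → Term P V
    perturbation []       = con P.0#
    perturbation (v ∷ vs) = perturbation vs ⊕ (var v ⊗ (con P.1# ⊕ (con (var tt) ⊗ perturbation vs)))

    perturb-correct : ∀ p vs → _~_ R (p ⊕ (con (εR F) ⊗ (p ⊗ mapPR (perturbation vs)))) (perturb p vs)
    perturb-correct p []       = T.trans (T.+-congˡ (T.trans (T.*-congˡ (T.zeroʳ p)) (T.zeroʳ _))) (T.+-identityʳ p)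
      where module T = CommutativeRing (termRing R V)
    perturb-correct p (v ∷ vs) = T.trans
      (solve 4 (λ p e q v → p :+ e :* (p :* (q :+ v :* (:con 1 :+ e :* q))) :=
        (p :+ e :* (p :* q)) :+ v :* (e :* (p :+ e :* (p :* q)))) T.refl
        p (con (εR F)) (mapPR (perturbation vs)) (var v))
      (T.+-cong (perturb-correct p vs) (T.*-congˡ (T.*-congˡ (perturb-correct p vs))))
      where
      module T = CommutativeRing (termRing R V)
      open import Algebra.Solver.Ring.NaturalCoefficients.Default T.commutativeSemiring
        using (solve; _:=_; _:+_; _:*_) renaming (con to :con)

    perturb-cong : ∀ {p q} vs → _~_ R p q → _~_ R (perturb p vs) (perturb q vs)
    perturb-cong []       e = e
    perturb-cong (v ∷ vs) e = ⊕-cong (perturb-cong vs e) (⊗-cong ~refl (⊗-cong ~refl (perturb-cong vs e)))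

    deg-perturb : ∀ p vs → deg R (perturb p vs) ℕ.≤ deg R p ℕ.+ length vs
    deg-perturb p []       = ℕ.≤-reflexive (≡.sym (ℕ.+-identityʳ _))
    deg-perturb p (v ∷ vs) = ℕ.≤-trans (ℕ.⊔-lub (ℕ.≤-trans (deg-perturb p vs) (ℕ.n≤1+n _)) (s≤s (deg-perturb p vs)))
      (ℕ.≤-reflexive (≡.sym (ℕ.+-suc (deg R p) (length vs))))

    deg-perturbation : ∀ vs → deg P (perturbation vs) ℕ.≤ length vs
    deg-perturbation []       = z≤n
    deg-perturbation (v ∷ vs) = ℕ.⊔-lub (ℕ.≤-trans (deg-perturbation vs) (ℕ.n≤1+n _)) (s≤s (deg-perturbation vs))

    FormulaBound : Term R V → ℕ → Set
    FormulaBound p s = ∃ λ φ → fsize R φ ℕ.≤ s × _~_ R φ p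

    -- `perturb` uses its predecessor twice, which in a tree would double the size with every
    -- factor. The factored form (1 + ε v) φ uses it once and adds six nodes.
    perturb-formula : ∀ {p s} vs → FormulaBound p s → FormulaBound (perturb p vs) (s ℕ.+ 6 ℕ.* length vs)
    perturb-formula {s = s} [] (φ , φ≤ , φ~) = φ , ℕ.≤-trans φ≤ (ℕ.m≤m+n s 0) , φ~
    perturb-formula {p} {s} (v ∷ vs) b with perturb-formula vs b
    ... | φ , φ≤ , φ~ = (con R.1# ⊕ (con (εR F) ⊗ var v)) ⊗ φ ,
      ℕ.≤-trans (ℕ.+-monoʳ-≤ 6 φ≤) (ℕ.≤-reflexive size) ,
      T.trans (T.*-congˡ φ~) (solve 3 (λ e v p → (:con 1 :+ e :* v) :* p := p :+ v :* (e :* p)) T.refl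
        (con (εR F)) (var v) (perturb p vs))
      where
      module T = CommutativeRing (termRing R V)
      open import Algebra.Solver.Ring.NaturalCoefficients.Default T.commutativeSemiring
        using (solve; _:=_; _:+_; _:*_) renaming (con to :con)
      size : 6 ℕ.+ (s ℕ.+ 6 ℕ.* length vs) ≡ s ℕ.+ 6 ℕ.* suc (length vs)
      size = ≡.trans (≡.sym (ℕ.+-assoc 6 s _)) (≡.trans (cong (ℕ._+ 6 ℕ.* length vs) (ℕ.+-comm 6 s))
        (≡.trans (ℕ.+-assoc s 6 _) (cong (s ℕ.+_) (≡.sym (ℕ.*-suc 6 (length vs))))))

  rename-perturb : ∀ {V W : Set} (ρ : V → W) p vs → rename R ρ (perturb p vs) ≡ perturb (rename R ρ p) (map ρ vs)
  rename-perturb ρ p []       = ≡.refl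
  rename-perturb ρ p (v ∷ vs) = cong (λ q → q ⊕ (var (ρ v) ⊗ (con (εR F) ⊗ q))) (rename-perturb ρ p vs)

  -- Perturbed circuits

  module _ {N : ℕ} where
    open Circuits using (inp; cst; add; mul; orc; []; _▷_)
    open Plain R N using (SLP; Skew; output)

    -- The flag lets one construction serve both VP and VBP.
    CircuitBound : Bool → Term R (Fin N) → ℕ → Set
    CircuitBound skew p s = ∃ λ k → Σ (SLP (suc k)) λ c → suc k ℕ.≤ s × (skew ≡ true → Skew c) × _~_ R (output c) p

    -- Five gates per factor: the leaf ε, a product, the leaf v, a product and a sum. Each product
    -- takes the leaf just before it as first input, which keeps skewness, and the sum reaches back
    -- four gates to reuse the old output.
    perturb-circuit : ∀ {skew p s} vs → CircuitBound skew p s → CircuitBound skew (perturb p vs) (s ℕ.+ 5 ℕ.* length vs)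
    perturb-circuit {s = s} [] (k , c , k≤ , sk , c~) = k , c , ℕ.≤-trans k≤ (ℕ.m≤m+n s 0) , sk , c~
    perturb-circuit {skew} {p} {s} (v ∷ vs) b with perturb-circuit vs b
    ... | k , (c ▷ g) , k≤ , sk , c~ = 5 ℕ.+ k ,
      ((((((c ▷ g) ▷ cst (εR F)) ▷ mul zero (suc zero)) ▷ inp v) ▷ mul zero (suc zero)) ▷
        add (suc (suc (suc (suc zero)))) zero) ,
      ℕ.≤-trans (ℕ.+-monoʳ-≤ 5 k≤) (ℕ.≤-reflexive size) ,
      (λ e → (sk e , inj₁ ≡.refl) , inj₁ ≡.refl) ,
      ⊕-cong c~ (⊗-cong ~refl (⊗-cong ~refl c~))
      where
      size : 5 ℕ.+ (s ℕ.+ 5 ℕ.* length vs) ≡ s ℕ.+ 5 ℕ.* suc (length vs)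
      size = ≡.trans (≡.sym (ℕ.+-assoc 5 s _)) (≡.trans (cong (ℕ._+ 5 ℕ.* length vs) (ℕ.+-comm 5 s))
        (≡.trans (ℕ.+-assoc s 5 _) (cong (s ℕ.+_) (≡.sym (ℕ.*-suc 5 (length vs))))))

  module _ {N N′ : ℕ} (ρ : Fin N → Fin N′) where
    open Circuits using (inp; cst; add; mul; []; _▷_)
    private
      module From = Plain C N
      module To = Plain R N′

    embed : Term C (Fin N) → Term R (Fin N′)
    embed a = rename R ρ (mapR a)

    embed-cong : ∀ {a b} → _~_ C a b → _~_ R (embed a) (embed b)
    embed-cong e = subst-cong _ (mapCoef-cong fromField e)

    embedGate : ∀ {k} → From.Gate k → To.Gate k
    embedGate (inp i)   = inp (ρ i)
    embedGate (cst c)   = cst (ιF F c)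
    embedGate (add i j) = add i j
    embedGate (mul i j) = mul i j

    embedSLP : ∀ {k} → From.SLP k → To.SLP k
    embedSLP []      = []
    embedSLP (c ▷ g) = embedSLP c ▷ embedGate g

    embed-values : ∀ {k} (c : From.SLP k) i → lookup (To.values (embedSLP c)) i ≡ embed (lookup (From.values c) i)
    embed-values (c ▷ inp _)   zero    = ≡.refl
    embed-values (c ▷ cst _)   zero    = ≡.refl
    embed-values (c ▷ add i j) zero    = cong₂ _⊕_ (embed-values c i) (embed-values c j)
    embed-values (c ▷ mul i j) zero    = cong₂ _⊗_ (embed-values c i) (embed-values c j)
    embed-values (c ▷ g)       (suc i) = embed-values c i

    embed-output : ∀ {k} (c : From.SLP (suc k)) → To.output (embedSLP c) ≡ embed (From.output c)
    embed-output (c ▷ g) with From.values (c ▷ g) | embed-values (c ▷ g) zero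
    ... | _ ∷ _ | e = e

    embed-leaves : ∀ {k} (c : From.SLP k) → To.leaves (embedSLP c) ≡ From.leaves c
    embed-leaves []              = ≡.refl
    embed-leaves (c ▷ inp _)     = cong (_ ∷_) (embed-leaves c)
    embed-leaves (c ▷ cst _)     = cong (_ ∷_) (embed-leaves c)
    embed-leaves (c ▷ add _ _)   = cong (_ ∷_) (embed-leaves c)
    embed-leaves (c ▷ mul _ _)   = cong (_ ∷_) (embed-leaves c)

    embed-skew : ∀ {k} (c : From.SLP k) → From.Skew c → To.Skew (embedSLP c)
    embed-skew []            _ = tt
    embed-skew (c ▷ inp _)   s = embed-skew c s
    embed-skew (c ▷ cst _)   s = embed-skew c s
    embed-skew (c ▷ add _ _) s = embed-skew c s
    embed-skew (c ▷ mul i j) (s , l) rewrite embed-leaves c = embed-skew c s , l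

    embed-circuit : ∀ {skew k s p} (c : From.SLP (suc k)) → suc k ℕ.≤ s → (skew ≡ true → From.Skew c) →
                    _~_ C (From.output c) p → CircuitBound skew (embed p) s
    embed-circuit {k = k} c k≤ sk c~ = k , embedSLP c , k≤ , embed-skew c ∘ sk ,
      ~trans (≡⇒~ (embed-output c)) (embed-cong c~)

  -- Perturbed Hamiltonian cycle polynomials

  module _ {V : Set} where
    private
      module T = CommutativeRing (termRing R V)
      open Hamiltonian (termRing R V)

    eval-HC : ∀ {D : RawRing 0ℓ 0ℓ} (i : RawRing.Carrier D → Term R V) → i (RawRing.0# D) ≡ con R.0# → i (RawRing.1# D) ≡ con R.1# →
              ∀ m (τ : Fin (m ℕ.* m) → Term R V) →
              eval {D} (termRing R V) i τ (HCpoly D m) ≡ hcSum D m (λ a b → τ (combine a b))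
    eval-HC {D} i i0 i1 m τ = go (nCycles D m)
      where
      prod : ∀ π xs → eval {D} (termRing R V) i τ (prodT D (map (λ a → var (combine a (π a))) xs)) ≡
             foldr _⊗_ (con R.1#) (map (λ a → τ (combine a (π a))) xs)
      prod π []       = i1
      prod π (x ∷ xs) = cong (τ (combine x (π x)) ⊗_) (prod π xs)
      go : ∀ πs → eval {D} (termRing R V) i τ (sumT D (map (λ π → prodT D (map (λ a → var (combine a (π a))) (allFin m))) πs)) ≡
           foldr _⊕_ (con R.0#) (map (λ π → foldr _⊗_ (con R.1#) (map (λ a → τ (combine a (π a))) (allFin m))) πs)
      go []       = i0
      go (π ∷ πs) = cong₂ _⊕_ (prod π (allFin m)) (go πs)

    -- A projection of `HC` read as a digraph whose edges are labelled by variables and constants,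
    -- the form on which the gadget acts.
    HamProjection : Term R V → ℕ → Set
    HamProjection p k = ∃ λ (E : Fin (suc k) → Fin (suc k) → V ⊎ R.Carrier) → p T.≈ ham λ i j → toTerm (E i j)

    toTerm-gadget : ∀ {k} e y (E : Fin (suc k) → Fin (suc k) → V ⊎ R.Carrier) i j →
      gadget T.0# T.1# (toTerm e) (toTerm y) (λ i j → toTerm (E i j)) i j ≡
      toTerm (gadget (inj₂ R.0#) (inj₂ R.1#) e y E i j)
    toTerm-gadget e y E zero          zero          = ≡.refl
    toTerm-gadget e y E zero          (suc zero)    = ≡.refl
    toTerm-gadget e y E zero          (suc (suc zero)) = ≡.refl
    toTerm-gadget e y E zero          (suc (suc (suc _))) = ≡.refl
    toTerm-gadget e y E (suc zero)    zero          = ≡.refl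
    toTerm-gadget e y E (suc zero)    (suc zero)    = ≡.refl
    toTerm-gadget e y E (suc zero)    (suc (suc zero)) = ≡.refl
    toTerm-gadget e y E (suc zero)    (suc (suc (suc _))) = ≡.refl
    toTerm-gadget e y E (suc (suc i)) zero          = ≡.refl
    toTerm-gadget e y E (suc (suc i)) (suc zero)    = ≡.refl
    toTerm-gadget e y E (suc (suc i)) (suc (suc zero)) = ≡.refl
    toTerm-gadget e y E (suc (suc i)) (suc (suc (suc j))) = ≡.refl

    -- Each factor replaces one vertex by three, hence two new vertices. With the summands in this
    -- order the size in the recursive case holds by computation.
    perturb-ham : ∀ {p k} vs → HamProjection p k → HamProjection (perturb p vs) (length vs ℕ.* 2 ℕ.+ k)
    perturb-ham []       h = h
    perturb-ham {p} {k} (v ∷ vs) h with perturb-ham vs h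
    ... | E , e = gadget (inj₂ R.0#) (inj₂ R.1#) (inj₂ (εR F)) (inj₁ v) E , (begin
      perturb p vs ⊕ (var v ⊗ (con (εR F) ⊗ perturb p vs))
        ≈⟨ T.+-cong e (T.*-congˡ (T.*-congˡ e)) ⟩
      ham M ⊕ (var v ⊗ (con (εR F) ⊗ ham M))
        ≈⟨ ham-gadget (con (εR F)) (var v) M ⟨
      ham (gadget T.0# T.1# (con (εR F)) (var v) M)
        ≈⟨ ham-cong {M = gadget T.0# T.1# (con (εR F)) (var v) M}
             {N = λ i j → toTerm (gadget (inj₂ R.0#) (inj₂ R.1#) (inj₂ (εR F)) (inj₁ v) E i j)}
             (λ i j → ≡⇒~ (toTerm-gadget (inj₂ (εR F)) (inj₁ v) E i j)) ⟩
      ham (λ i j → toTerm (gadget (inj₂ R.0#) (inj₂ R.1#) (inj₂ (εR F)) (inj₁ v) E i j)) ∎)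
      where
      open import Relation.Binary.Reasoning.Setoid T.setoid
      M : Fin (suc (length vs ℕ.* 2 ℕ.+ k)) → Fin (suc (length vs ℕ.* 2 ℕ.+ k)) → Term R V
      M i j = toTerm (E i j)

  hamProjection⇒≤proj : ∀ {N k} {p : Term R (Fin N)} → HamProjection p k → _≤proj_ R p (HCpoly R (suc k))
  hamProjection⇒≤proj {N} {k} {p} (E , e) = σ , (begin
    p                                               ≈⟨ e ⟩
    ham M                                           ≈⟨ ham-cong {k} {M} {M′} entries ⟩
    ham M′                                          ≈⟨ hcSum≈ham R k M′ ⟨
    hcSum R n M′                                    ≡⟨ eval-HC {D = R} con ≡.refl ≡.refl n (projSubst R σ) ⟨
    eval {R} (termRing R _) con (projSubst R σ) (HCpoly R n) ≡⟨ subst≡eval (projSubst R σ) (HCpoly R n) ⟨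
    subst R (projSubst R σ) (HCpoly R n)            ∎)
    where
    open Hamiltonian (termRing R (Fin N))
    module T = CommutativeRing (termRing R (Fin N))
    open import Relation.Binary.Reasoning.Setoid T.setoid
    n = suc k
    σ : Fin (n ℕ.* n) → Fin N ⊎ R.Carrier
    σ = uncurry E ∘ remQuot {n} n
    M M′ : Fin n → Fin n → Term R (Fin N)
    M i j = toTerm (E i j)
    M′ i j = projSubst R σ (combine i j)
    entries : ∀ i j → M i j T.≈ M′ i j
    entries i j = ≡⇒~ (≡.sym (≡.trans (projSubst≡toTerm σ (combine i j))
      (cong (toTerm ∘ uncurry E) (Fin.remQuot-combine {n} i j))))

  -- `ham` is indexed by one less than the number of vertices. `HC` at index 0 is the empty sum, so
  -- it is represented by the zero matrix on two vertices, the smallest size at which `ham-expand`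
  -- applies.
  hamSize : ℕ → ℕ
  hamSize zero    = 1
  hamSize (suc k) = k

  module _ {N N′ : ℕ} (ρ : Fin N → Fin N′) where
    private
      module T = CommutativeRing (termRing R (Fin N′))
      open Hamiltonian (termRing R (Fin N′))
      open import Relation.Binary.Reasoning.Setoid T.setoid

    embedEntry : Fin N ⊎ F.Carrier → Fin N′ ⊎ R.Carrier
    embedEntry = Sum.map ρ (ιF F)

    toTerm-embedEntry : ∀ x → toTerm (embedEntry x) ≡ embed ρ (toTerm x)
    toTerm-embedEntry (inj₁ _) = ≡.refl
    toTerm-embedEntry (inj₂ _) = ≡.refl

    embed-HC : ∀ {p : Term C (Fin N)} m (σ : Fin (m ℕ.* m) → Fin N ⊎ F.Carrier) →
               _~_ C p (subst C (projSubst C σ) (HCpoly C m)) →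
               embed ρ p T.≈ hcSum C m (λ i j → toTerm (embedEntry (σ (combine i j))))
    embed-HC {p} m σ e = begin
      embed ρ p
        ≈⟨ embed-cong ρ e ⟩
      embed ρ (subst C (projSubst C σ) (HCpoly C m))
        ≡⟨ cong (rename R ρ) (mapCoef-subst {C} {R} (ιF F) (projSubst C σ) (HCpoly C m)) ⟩
      rename R ρ (subst R (mapR ∘ projSubst C σ) (mapR (HCpoly C m)))
        ≡⟨ subst-subst _ (mapR ∘ projSubst C σ) (mapR (HCpoly C m)) ⟩
      subst R (embed ρ ∘ projSubst C σ) (mapR (HCpoly C m))
        ≡⟨ subst-ext (λ v → ≡.trans (cong (embed ρ) (projSubst≡toTerm σ v)) (≡.sym (toTerm-embedEntry (σ v))))
             (mapR (HCpoly C m)) ⟩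
      subst R τ (mapR (HCpoly C m))
        ≡⟨ ≡.trans (subst≡eval τ (mapR (HCpoly C m))) (eval-mapCoef {C} {R} (termRing R _) (ιF F) con τ (HCpoly C m)) ⟩
      eval {C} (termRing R _) (con ∘ ιF F) τ (HCpoly C m)
        ≡⟨ eval-HC {D = C} (con ∘ ιF F) ≡.refl ≡.refl m τ ⟩
      hcSum C m (λ i j → τ (combine i j)) ∎
      where
      τ : Fin (m ℕ.* m) → Term R (Fin N′)
      τ = toTerm ∘ embedEntry ∘ σ

    embed-hamProjection : ∀ {p : Term C (Fin N)} m → _≤proj_ C p (HCpoly C m) → HamProjection (embed ρ p) (hamSize m)
    embed-hamProjection zero    (σ , e) = (λ _ _ → inj₂ R.0#) , T.trans (embed-HC 0 σ e) (T.sym (ham-zero {0}))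
    embed-hamProjection (suc k) (σ , e) = (λ i j → embedEntry (σ (combine i j))) ,
      T.trans (embed-HC (suc k) σ e) (hcSum≈ham C k (λ i j → toTerm (embedEntry (σ (combine {suc k} {suc k} i j)))))

  -- Membership of the perturbed family

  perturbing : Fam C → Fam P
  perturbing f = record
    { nv  = nv f
    ; pol = λ n → mapP (pol f n) ⊗ perturbation (allFin (nv f n)) }

  length-allFin : ∀ n → length (allFin n) ≡ n
  length-allFin n = length-tabulate {n = n} id

  perturbing-pFam : ∀ {f} → PFam C f → PFam P (perturbing f)
  perturbing-pFam {f} (pn , d , pd , low) = pn , (λ n → d n ℕ.+ nv f n) , polyBounded-+ pd pn , λ n →
    let (a , a~ , degA) = low n in
    mapP a ⊗ perturbation (allFin (nv f n)) ,
    ⊗-cong (mapCoef-cong toPoly a~) ~refl ,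
    ℕ.+-mono-≤ (ℕ.≤-trans (ℕ.≤-reflexive (deg-mapCoef {C} {P} con a)) degA)
      (ℕ.≤-trans (deg-perturbation (allFin (nv f n))) (ℕ.≤-reflexive (length-allFin (nv f n))))

  module _ (f : Fam C) where
    private
      h = plusEps F f (perturbing f)
      ρ : ∀ n → Fin (nv f n) → Fin (nv h n)
      ρ n i = inject≤ i (ℕ.m≤m⊔n (nv f n) (nv f n))
      vars : ∀ n → List (Fin (nv h n))
      vars n = map (ρ n) (allFin (nv f n))
      length-vars : ∀ n → length (vars n) ≡ nv f n
      length-vars n = ≡.trans (length-map (ρ n) (allFin (nv f n))) (length-allFin (nv f n))

    perturbed~ : ∀ n → _~_ R (pol h n) (rename R (ρ n) (perturb (mapR (pol f n)) (allFin (nv f n))))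
    perturbed~ n = ~trans
      (⊕-cong ~refl (⊗-cong ~refl (⊗-cong (≡⇒~ (cong (rename R (ρ n)) (mapPR-mapP (pol f n)))) ~refl)))
      (subst-cong _ (perturb-correct (mapR (pol f n)) (allFin (nv f n))))

    perturbed~′ : ∀ n → _~_ R (perturb (embed (ρ n) (pol f n)) (vars n)) (pol h n)
    perturbed~′ n = ~sym (~trans (perturbed~ n) (≡⇒~ (rename-perturb (ρ n) (mapR (pol f n)) (allFin (nv f n)))))

    perturbed-pFam : PFam C f → PFam R h
    perturbed-pFam (pn , d , pd , low) =
      polyBounded-≤ (λ n → ℕ.m⊔n≤m+n (nv f n) (nv f n)) (polyBounded-+ pn pn) ,
      (λ n → d n ℕ.+ nv f n) , polyBounded-+ pd pn , λ n →
      let (a , a~ , degA) = low n in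
      perturb (embed (ρ n) a) (vars n) ,
      ~trans (perturb-cong (vars n) (embed-cong (ρ n) a~)) (perturbed~′ n) ,
      ℕ.≤-trans (deg-perturb (embed (ρ n) a) (vars n)) (ℕ.+-mono-≤
        (ℕ.≤-trans (ℕ.≤-reflexive (≡.trans (deg-rename (ρ n) (mapR a)) (deg-mapCoef {C} {R} (ιF F) a))) degA)
        (ℕ.≤-reflexive (length-vars n)))

    private
      slack : ∀ c s n → s ℕ.+ c ℕ.* length (vars n) ℕ.≤ s ℕ.+ c ℕ.* nv f n
      slack c s n = ℕ.≤-reflexive (cong (λ l → s ℕ.+ c ℕ.* l) (length-vars n))

    perturbed-member : ∀ 𝒞 → Member C 𝒞 f → Member R 𝒞 h
    perturbed-member VNP (Pf , t , pt , proj) = perturbed-pFam Pf , t′ ,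
      polyBounded-≤ (λ n → s≤s (ℕ.+-monoʳ-≤ (nv f n ℕ.* 2) (hamSize≤ (t n))))
        (polyBounded-+ (polyBounded-const 1) (polyBounded-+
          (polyBounded-≤ (λ n → ℕ.≤-reflexive (ℕ.*-comm (nv f n) 2)) (polyBounded-* 2 (proj₁ Pf)))
          (polyBounded-+ (polyBounded-const 1) pt))) ,
      λ n → project n (hamProjection⇒≤proj (≡.subst (λ l → HamProjection (hₙ n) (l ℕ.* 2 ℕ.+ hamSize (t n))) (length-vars n)
        (perturb-ham (vars n) (embed-hamProjection (ρ n) (t n) (proj n)))))
      where
      hₙ = λ n → perturb (embed (ρ n) (pol f n)) (vars n)
      t′ : ℕ → ℕ
      t′ n = suc (nv f n ℕ.* 2 ℕ.+ hamSize (t n))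
      hamSize≤ : ∀ m → hamSize m ℕ.≤ suc m
      hamSize≤ zero    = ℕ.≤-refl
      hamSize≤ (suc m) = ℕ.≤-trans (ℕ.n≤1+n m) (ℕ.n≤1+n (suc m))
      project : ∀ n → _≤proj_ R (hₙ n) (HCpoly R (t′ n)) → _≤proj_ R (pol h n) (HCpoly R (t′ n))
      project n (σ , e) = σ , ~trans (~sym (perturbed~′ n)) e
    perturbed-member VP (Pf , s , ps , circ) = perturbed-pFam Pf , (λ n → s n ℕ.+ 5 ℕ.* nv f n) ,
      polyBounded-+ ps (polyBounded-* 5 (proj₁ Pf)) , size
      where
      size : ∀ n → CircSize≤ R (pol h n) (s n ℕ.+ 5 ℕ.* nv f n)
      size n with circ n
      ... | k , c , k≤ , c~ with perturb-circuit (vars n) (embed-circuit (ρ n) {skew = false} c k≤ (λ ()) c~)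
      ... | k′ , c′ , k′≤ , _ , c′~ = k′ , c′ , ℕ.≤-trans k′≤ (slack 5 (s n) n) , ~trans c′~ (perturbed~′ n)
    perturbed-member VBP (Pf , s , ps , circ) = perturbed-pFam Pf , (λ n → s n ℕ.+ 5 ℕ.* nv f n) ,
      polyBounded-+ ps (polyBounded-* 5 (proj₁ Pf)) , size
      where
      size : ∀ n → SkewSize≤ R (pol h n) (s n ℕ.+ 5 ℕ.* nv f n)
      size n with circ n
      ... | k , c , k≤ , sk , c~ with perturb-circuit (vars n) (embed-circuit (ρ n) {skew = true} c k≤ (λ _ → sk) c~)
      ... | k′ , c′ , k′≤ , sk′ , c′~ =
        k′ , c′ , ℕ.≤-trans k′≤ (slack 5 (s n) n) , sk′ ≡.refl , ~trans c′~ (perturbed~′ n)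
    perturbed-member VF (Pf , s , ps , form) = perturbed-pFam Pf , (λ n → s n ℕ.+ 6 ℕ.* nv f n) ,
      polyBounded-+ ps (polyBounded-* 6 (proj₁ Pf)) , size
      where
      size : ∀ n → FormSize≤ R (pol h n) (s n ℕ.+ 6 ℕ.* nv f n)
      size n with form n
      ... | φ , φ≤ , φ~ with perturb-formula {s = s n} (vars n) (embed (ρ n) φ ,
              ℕ.≤-trans (ℕ.≤-reflexive (≡.trans (fsize-rename (ρ n) (mapR φ)) (fsize-mapCoef {C} {R} (ιF F) φ))) φ≤ ,
              embed-cong (ρ n) φ~)
      ... | φ′ , φ′≤ , φ′~ = φ′ , ℕ.≤-trans φ′≤ (slack 6 (s n) n) , ~trans φ′~ (perturbed~′ n)

  -- Non-completeness of the perturbed family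

  IsLeaf : ∀ {V : Set} → Term R V → Set
  IsLeaf {V} t = ∃ λ (x : V ⊎ R.Carrier) → t ≡ toTerm x

  module _ {V W : Set} (τ : V → Term R W) where
    private
      module T = CommutativeRing (termRing R W)
      open import Algebra.Solver.Ring.NaturalCoefficients.Default T.commutativeSemiring
        using (solve; _:=_; _:+_; _:*_) renaming (con to :con)

    perturb-vanishes : ∀ p {v vs} → v ∈ vs → τ v ≡ con -ε⁻¹ → subst R τ (perturb p vs) T.≈ con R.0#
    perturb-vanishes p {vs = v ∷ vs} (here ≡.refl) e rewrite e = T.trans
      (solve 3 (λ q c ε → q :+ c :* (ε :* q) := (:con 1 :+ c :* ε) :* q) T.refl
        (subst R τ (perturb p vs)) (con -ε⁻¹) (con (εR F)))
      (T.trans (T.*-congʳ 1-ε⁻¹ε) (T.zeroˡ _))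
    perturb-vanishes p {vs = v ∷ vs} (there v∈) e with perturb-vanishes p v∈ e
    ... | z = T.trans (T.+-cong z (T.trans (T.*-congˡ (T.trans (T.*-congˡ z) (T.zeroʳ _))) (T.zeroʳ _))) (T.+-identityʳ _)

  -- If some variable survives the projection τ, send the remaining variables to −1/ε, which kills
  -- the factor of that variable; otherwise the projected polynomial is constant.
  var-not-projection : ∀ {n} {W : Set} {w : W} p (τ : Fin n → Term R W) → (∀ i → IsLeaf (τ i)) →
                       ¬ _~_ R (var w) (subst R τ (perturb p (allFin n)))
  var-not-projection {n} {W} {w} p τ leaf w~ with any? (λ i → isVar? (proj₁ (leaf i)))
    where
    isVar? : (x : W ⊎ R.Carrier) → Dec (∃ λ u → x ≡ inj₁ u)
    isVar? (inj₁ u) = yes (u , ≡.refl)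
    isVar? (inj₂ _) = no λ ()
  -- The substitution sends w itself to -1/ε, so the supposed identity gives -1/ε = 0, and then 1 =
  -- 1 + (-1/ε) ε = 0.
  ... | yes (i , u , e) = Rat-1≉0 F {W} (T.trans (T.sym (T.trans (T.+-congˡ
        (T.trans (T.*-congʳ -ε⁻¹≈0) (T.zeroˡ _))) (T.+-identityʳ _))) 1-ε⁻¹ε)
    where
    module T = CommutativeRing (termRing R W)
    θ : W → Term R W
    θ _ = con -ε⁻¹
    -ε⁻¹≈0 : con -ε⁻¹ T.≈ con R.0#
    -ε⁻¹≈0 = T.trans (subst-cong θ w~) (T.trans (≡⇒~ (subst-subst θ τ (perturb p (allFin n))))
      (perturb-vanishes (subst R θ ∘ τ) p (∈-allFin i)
        (cong (subst R θ) (≡.trans (proj₂ (leaf i)) (cong toTerm e)))))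
  -- The constant right-hand side is unchanged when w is set to 1 and to 0, which forces 1 = 0.
  ... | no none = Rat-1≉0 F {W} (~trans (subst-cong (λ _ → con R.1#) w~)
      (~trans (≡⇒~ (≡.trans (closed _) (≡.sym (closed _)))) (~sym (subst-cong (λ _ → con R.0#) w~))))
    where
    closed : ∀ (θ : W → Term R W) → subst R θ (subst R τ (perturb p (allFin n))) ≡ subst R τ (perturb p (allFin n))
    closed θ = ≡.trans (subst-subst θ τ (perturb p (allFin n)))
      (subst-ext (λ i → constant i (proj₁ (leaf i)) ≡.refl) (perturb p (allFin n)))
      where
      constant : ∀ i x → proj₁ (leaf i) ≡ x → subst R θ (τ i) ≡ τ i
      constant i (inj₁ u) e = contradiction (i , u , e) none
      constant i (inj₂ c) e rewrite ≡.trans (proj₂ (leaf i)) (cong toTerm e) = ≡.refl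

  singleVar : Fam C
  singleVar = record { nv = λ _ → 1 ; pol = λ _ → var zero }

  singleVar-member : ∀ 𝒞 → Member C 𝒞 singleVar
  singleVar-member 𝒞 = member 𝒞
    where
    open Circuits using (inp; []; _▷_)
    one : PolyBounded (λ _ → 1)
    one = polyBounded-const 1
    pFam : PFam C singleVar
    pFam = one , (λ _ → 1) , one , λ n → var zero , ~refl , ℕ.≤-refl
    member : ∀ 𝒞 → Member C 𝒞 singleVar
    -- `HC` at index 1 consists of the loop on one vertex: its only variable, times the empty
    -- product, plus the empty sum.
    member VNP = pFam , (λ _ → 1) , one , λ n → (λ _ → inj₁ zero) , ~sym (~trans (⊕-zero _) (⊗-one _))
    member VP  = pFam , (λ _ → 1) , one , λ n → 0 , ([] ▷ inp zero) , ℕ.≤-refl , ~refl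
    member VBP = pFam , (λ _ → 1) , one , λ n → 0 , ([] ▷ inp zero) , ℕ.≤-refl , tt , ~refl
    member VF  = pFam , (λ _ → 1) , one , λ n → var zero , ℕ.≤-refl , ~refl

  -- Completeness over F makes a variable a projection of some member of `K`. After extending the
  -- coefficients to F(ε), this composes with the assumed projection to a substitution by leaves,
  -- which `var-not-projection` excludes.
  perturbed-incomplete : ∀ 𝒞 {f K} → IsComplete C 𝒞 K → ¬ _≤p_ R (embF F K) (plusEps F f (perturbing f))
  perturbed-incomplete 𝒞 {f} {K} (_ , complete) (t′ , _ , projK) with complete singleVar (singleVar-member 𝒞)
  ... | t , _ , projX with projX 0
  ... | σ , x~ with projK (t 0)
  ... | σ′ , K~ = var-not-projection (mapR (pol f n)) τ leaf (begin
    var zero                                                     ≈⟨ mapCoef-cong fromField x~ ⟩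
    mapR (subst C (projSubst C σ) (pol K (t 0)))                 ≡⟨ mapCoef-subst {C} {R} (ιF F) (projSubst C σ) (pol K (t 0)) ⟩
    subst R σᴿ (mapR (pol K (t 0)))                              ≈⟨ subst-cong σᴿ K~ ⟩
    subst R σᴿ (subst R (projSubst R σ′) (pol h n))              ≈⟨ subst-cong σᴿ (subst-cong (projSubst R σ′) (perturbed~ f n)) ⟩
    subst R σᴿ (subst R (projSubst R σ′) (rename R ρ q))         ≡⟨ cong (subst R σᴿ) (subst-subst (projSubst R σ′) _ q) ⟩
    subst R σᴿ (subst R (projSubst R σ′ ∘ ρ) q)                  ≡⟨ subst-subst σᴿ _ q ⟩
    subst R τ q                                                  ∎)
    where
    open import Relation.Binary.Reasoning.Setoid (CommutativeRing.setoid (termRing R (Fin 1)))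
    h = plusEps F f (perturbing f)
    n = t′ (t 0)
    q = perturb (mapR (pol f n)) (allFin (nv f n))
    ρ : Fin (nv f n) → Fin (nv h n)
    ρ i = inject≤ i (ℕ.m≤m⊔n (nv f n) (nv f n))
    σᴿ : Fin (nv K (t 0)) → Term R (Fin 1)
    σᴿ = mapR ∘ projSubst C σ
    τ : Fin (nv f n) → Term R (Fin 1)
    τ i = subst R σᴿ (projSubst R σ′ (ρ i))
    leaf : ∀ i → IsLeaf (τ i)
    leaf i with σ′ (ρ i)
    ... | inj₂ c = inj₂ c , ≡.refl
    ... | inj₁ w with σ w
    ... | inj₁ u = inj₁ u , ≡.refl
    ... | inj₂ c = inj₂ (ιF F c) , ≡.refl

-- Both density statements together

member⇒pFam : ∀ {C} 𝒞 {f} → Member C 𝒞 f → PFam C f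
member⇒pFam VNP = proj₁
member⇒pFam VP  = proj₁
member⇒pFam VBP = proj₁
member⇒pFam VF  = proj₁

theorem1 : (F : Field) (⪯ : Red) (𝒞 : Class) (K : Fam (Fraw F)) →
    IsComplete (Fraw F) 𝒞 K →
    (f : Fam (Fraw F)) → Member (Fraw F) 𝒞 f →
    (Σ (Fam (PolyRaw F)) λ g → PFam (PolyRaw F) g ×
    Reduces F ⪯ (embF F K) (plusEps F f g))
    × (Σ (Fam (PolyRaw F)) λ g → PFam (PolyRaw F) g ×
    Member (RatRaw F) 𝒞 (plusEps F f g) ×
    ¬ (_≤p_ (RatRaw F) (embF F K) (plusEps F f g)))
theorem1 F ⪯ 𝒞 K complete f f∈ =
  (completing F f K , completing-pFam F {f} {K} Pf PK , dense-complete F ⪯ f K Pf PK) ,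
  (perturbing F f , perturbing-pFam F {f} Pf , perturbed-member F f 𝒞 f∈ , perturbed-incomplete F 𝒞 {f} {K} complete)
  where
  Pf = member⇒pFam 𝒞 {f} f∈
  PK = member⇒pFam 𝒞 {K} (proj₁ complete)
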